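{- Let $p,n\in\mathbb N$ with $p\ge n\ge 10$, and write $p=k(n-1)+r$ with $k\in\mathbb N$ and $r\in\{0,1,2,n-5,n-4,n-3,n-2\}$. Then $$\mathrm{ex}(p;T_n^3)=\frac{(n-2)p-r(n-1-r)}2.$$
   Context: All graphs are finite simple graphs. For a graph $L$, $\mathrm{ex}(p;L)$ denotes the maximum number of edges in a graph on $p$ vertices that contains no subgraph isomorphic to $L$. For $n\ge 6$, $T_n^3$ is the tree on vertex set $\{v_0,\ldots,v_{n-1}\}$ with edge set $\{v_0v_1,v_0v_2,\ldots,v_0v_{n-4},\ v_1v_{n-3},\ v_1v_{n-2},\ v_1v_{n-1}\}$. $\mathbb N=\{1,2,\ldots\}$. -}

module Defs where

open import Level using (0ℓ)
open import Data.Nat using (ℕ; _∸_; _≤_; _≥_; _≤?_; _≟_; s≤s)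
open import Data.Fin using (Fin; toℕ; _<?_)
open import Data.List using (length; filter; allFin; cartesianProduct)
open import Data.Product using (Σ; ∃-syntax; _×_; _,_)
open import Data.Sum using (_⊎_; inj₁; inj₂; swap)
open import Function.Definitions using (Injective)
open import Relation.Nullary using (¬_)
open import Relation.Nullary.Decidable using (_×-dec_; _⊎-dec_)
open import Relation.Binary using (Rel; Symmetric; Irreflexive; Decidable)
open import Relation.Binary.PropositionalEquality using (_≡_; refl)

-- Adjacency is required to be decidable so that edges can be counted
-- constructively; classically this is no restriction.
record Graph (n : ℕ) : Set₁ where
  field
    Adj         : Rel (Fin n) 0ℓ
    adj?        : Decidable Adj
    symmetric   : Symmetric Adj
    irreflexive : Irreflexive _≡_ Adj

open Graph public

-- Each edge {i , j} is counted once, as the pair with i < j.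
edgeCount : ∀ {n} → Graph n → ℕ
edgeCount {n} G =
  length (filter (λ (i , j) → (i <? j) ×-dec adj? G i j)
                 (cartesianProduct (allFin n) (allFin n)))

-- A subgraph of G isomorphic to L is the image of an injective,
-- adjacency-preserving map; it need not be induced, so adjacency
-- is not required to be reflected.
Contains : ∀ {p m} → Graph p → Graph m → Set
Contains {p} {m} G L =
  Σ (Fin m → Fin p) λ f →
    Injective _≡_ _≡_ f × (∀ {i j} → Adj L i j → Adj G (f i) (f j))

_Free : ∀ {m p} → Graph m → Graph p → Set
(L Free) G = ¬ Contains G L

-- IsEx p L e  means  ex(p; L) = e.
record IsEx (p : ℕ) {m : ℕ} (L : Graph m) (e : ℕ) : Set₁ where
  field
    attained   : ∃[ G ] ((L Free) G × edgeCount {p} G ≡ e)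
    upperBound : (G : Graph p) → (L Free) G → edgeCount G ≤ e

-- The edges vᵢvⱼ of Tₙ³, oriented so that i < j (when n ≥ 6).
T³-Edge : (n : ℕ) → Rel (Fin n) 0ℓ
T³-Edge n i j =
    (toℕ i ≡ 0 × 1 ≤ toℕ j × toℕ j ≤ n ∸ 4)
  ⊎ (toℕ i ≡ 1 × n ∸ 3 ≤ toℕ j × toℕ j ≤ n ∸ 1)

private
  edge? : ∀ n → Decidable (T³-Edge n)
  edge? n i j =
    ((toℕ i ≟ 0) ×-dec (1 ≤? toℕ j) ×-dec (toℕ j ≤? n ∸ 4))
    ⊎-dec
    ((toℕ i ≟ 1) ×-dec (n ∸ 3 ≤? toℕ j) ×-dec (toℕ j ≤? n ∸ 1))

  no-loop : ∀ {n} → n ≥ 6 → ∀ i → ¬ T³-Edge n i i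
  no-loop _ i (inj₁ (i≡0 , 1≤i , _)) with toℕ i
  no-loop _ i (inj₁ (refl , () , _)) | _
  no-loop n≥6 i (inj₂ (i≡1 , n-3≤i , _)) with toℕ i
  no-loop (s≤s (s≤s (s≤s (s≤s (s≤s _))))) i (inj₂ (refl , s≤s () , _)) | _

T³ : (n : ℕ) → n ≥ 6 → Graph n
T³ n n≥6 = record
  { Adj         = λ i j → T³-Edge n i j ⊎ T³-Edge n j i
  ; adj?        = λ i j → edge? n i j ⊎-dec edge? n j i
  ; symmetric   = swap
  ; irreflexive = λ { {i} refl (inj₁ e) → no-loop n≥6 i e
                    ; {i} refl (inj₂ e) → no-loop n≥6 i e }
  }

{-# OPTIONS --safe #-}

-- Put N = n - 1.  If uv is an edge with d(u) ≥ N - 3 and d(v) ≥ 4, then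
-- |N(u) ∪ N(v)| ≤ N, since otherwise Tₙ³ embeds with v₀ = u and v₁ = v.
-- For the upper bound, let E(W) be the degree sum of G[W].  If |W| ≥ N, then
-- either all degrees in G[W] are at most N - 3, or there is S ⊆ W with |S| = N
-- whose edges to the rest of W are at most as many as the non-edges inside S,
-- so that E(W) ≤ N(N - 1) + E(W ∖ S).  Induction on k then gives
-- E(W) ≤ kN(N - 1) + r(r - 1) as soon as r(N - r) ≤ 2(N + r), which holds for
-- the listed r.  The set S is found as follows (degrees taken in G[W]):
--   * N vertices of degree at most 3, if there are that many; if not, no degree
--     exceeds N - 1, because all neighbours of such a vertex have degree ≤ 3;
--   * N[u], if d(u) = N - 1;
--   * N[u] with one more vertex, if d(u) = N - 2 is the maximum degree.
-- Equality holds for k disjoint copies of K_N together with one K_r.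

module Submission where

open import Defs
open import Data.Bool as Bool using (Bool; true; false; _∧_; _∨_; not)
open import Data.Empty using (⊥; ⊥-elim)
open import Data.Fin as Fin using (Fin; zero; suc; toℕ)
import Data.Fin.Properties as Fin
open import Data.Integer as ℤ using (+_)
import Data.Integer.Properties as ℤ
open import Data.List using (_∷_; []; _++_; length; filter; tabulate; allFin; cartesianProduct; map)
open import Data.List.Membership.Propositional using (_∈_)
open import Data.List.Properties using (filter-++; length-++; map-tabulate)
open import Data.List.Relation.Unary.Any using (here; there)
open import Data.Nat as ℕ using (ℕ; zero; suc; _+_; _*_; _∸_; _≤_; _<_; _≥_; _≤?_; _≟_; _≤ᵇ_; z≤n; s≤s; s≤s⁻¹)
open import Data.Nat.DivMod using (m≡m%n+[m/n]*n; m<n⇒m/n≡0; m/n≡1+[m∸n]/n; m%n<n)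
open import Data.Nat.Properties
open import Data.Nat.Tactic.RingSolver using (solve-∀)
open import Data.Product using (∃-syntax; _×_; _,_; proj₁; proj₂)
open import Data.Rational using (_/_)
open import Data.Rational.Properties using (fromℚᵘ-cong)
open import Data.Rational.Unnormalised using (mkℚᵘ; *≡*)
open import Data.Sum using (_⊎_; inj₁; inj₂)
open import Function using (id)
open import Function.Bundles using (mk⇔)
open import Function.Definitions using (Injective)
open import Level using (0ℓ)
open import Relation.Binary using (tri<; tri≈; tri>)
open import Relation.Binary.PropositionalEquality
open import Relation.Nullary using (¬_; Dec; yes; no; does; contradiction; ¬?)
open import Relation.Nullary.Decidable using (dec-true; dec-false; does-⇔; _×-dec_)
open import Relation.Unary using (Pred; Decidable)
open import Algebra.Properties.Semiring.Sum +-*-semiring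
  using (sum; ∑-distrib-+; ∑-comm; sum-cong-≗; *-distribˡ-sum)

-- Decidable vertex sets, their sizes and sums over them.

VSet : ℕ → Set
VSet p = Fin p → Bool

infixr 6 _∩_
infixr 5 _∪_
infixl 6 _∖_
infix 4 _⊑_

_∩_ _∪_ _∖_ : ∀ {p} → VSet p → VSet p → VSet p
(P ∩ Q) i = P i ∧ Q i
(P ∪ Q) i = P i ∨ Q i
(P ∖ Q) i = P i ∧ not (Q i)

｛_｝ : ∀ {p} → Fin p → VSet p
｛ x ｝ i = does (i Fin.≟ x)

_⊑_ : ∀ {p} → VSet p → VSet p → Set
P ⊑ Q = ∀ i → P i ≡ true → Q i ≡ true

⟦_⟧ : Bool → ℕ
⟦ false ⟧ = 0
⟦ true ⟧  = 1

∧-intro : ∀ {a b} → a ≡ true → b ≡ true → a ∧ b ≡ true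
∧-intro refl refl = refl

∧-elim : ∀ a {b} → a ∧ b ≡ true → a ≡ true × b ≡ true
∧-elim true eq = refl , eq

∧-false : ∀ b → b ∧ false ≡ false
∧-false true  = refl
∧-false false = refl

∨-elim : ∀ a {b} → a ∨ b ≡ true → a ≡ true ⊎ b ≡ true
∨-elim true  eq = inj₁ refl
∨-elim false eq = inj₂ eq

∨-introˡ : ∀ {a} b → a ≡ true → a ∨ b ≡ true
∨-introˡ b refl = refl

∨-introʳ : ∀ a {b} → b ≡ true → a ∨ b ≡ true
∨-introʳ true  eq = refl
∨-introʳ false eq = eq

true≢false : ∀ {b} → b ≡ true → b ≡ false → ⊥
true≢false refl ()

not-elim : ∀ {b} → not b ≡ true → b ≡ true → ⊥
not-elim {false} _ ()

not-intro : ∀ {b} → b ≡ false → not b ≡ true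
not-intro refl = refl

∈-single : ∀ {p} (x : Fin p) → ｛ x ｝ x ≡ true
∈-single x = dec-true (x Fin.≟ x) refl

single-elim : ∀ {p} {x : Fin p} i → ｛ x ｝ i ≡ true → i ≡ x
single-elim {x = x} i eq with i Fin.≟ x
single-elim i eq | yes i≡x = i≡x
single-elim i () | no _

∩⊑ˡ : ∀ {p} (P Q : VSet p) → P ∩ Q ⊑ P
∩⊑ˡ P Q i eq = proj₁ (∧-elim (P i) eq)

sum-mono : ∀ {p} {f g : Fin p → ℕ} → (∀ i → f i ≤ g i) → sum f ≤ sum g
sum-mono {zero}  f≤g = z≤n
sum-mono {suc p} f≤g = +-mono-≤ (f≤g zero) (sum-mono (λ i → f≤g (suc i)))

opaque
  # : ∀ {p} → VSet p → ℕ
  # P = sum (λ i → ⟦ P i ⟧)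

  ∑∈ : ∀ {p} → VSet p → (Fin p → ℕ) → ℕ
  ∑∈ P f = sum (λ i → ⟦ P i ⟧ * f i)

  #≡sum : ∀ {p} (P : VSet p) → # P ≡ sum (λ i → ⟦ P i ⟧)
  #≡sum P = refl

  ∑∈-full : ∀ {p} (f : Fin p → ℕ) → ∑∈ (λ _ → true) f ≡ sum f
  ∑∈-full f = sum-cong-≗ λ i → +-identityʳ (f i)

  #-cong : ∀ {p} {P Q : VSet p} → (∀ i → P i ≡ Q i) → # P ≡ # Q
  #-cong P≗Q = sum-cong-≗ λ i → cong ⟦_⟧ (P≗Q i)

  ∑∈-cong : ∀ {p} {S : VSet p} {f g : Fin p → ℕ} → (∀ i → f i ≡ g i) → ∑∈ S f ≡ ∑∈ S g
  ∑∈-cong {S = S} f≗g = sum-cong-≗ λ i → cong (⟦ S i ⟧ *_) (f≗g i)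

  #-∩ : ∀ {p} (P Q : VSet p) → # (P ∩ Q) ≡ ∑∈ P (λ i → ⟦ Q i ⟧)
  #-∩ P Q = sum-cong-≗ λ i → ∧-* (P i) (Q i)
    where
    ∧-* : ∀ b c → ⟦ b ∧ c ⟧ ≡ ⟦ b ⟧ * ⟦ c ⟧
    ∧-* false c = refl
    ∧-* true  c = sym (+-identityʳ ⟦ c ⟧)

  -- Double counting: with `f` the adjacency indicator, edges between `R` and `S` are counted from
  -- either end.
  ∑∈-swap : ∀ {p} (R S : VSet p) (f : Fin p → Fin p → ℕ) →
            ∑∈ R (λ i → ∑∈ S (f i)) ≡ ∑∈ S (λ j → ∑∈ R (λ i → f i j))
  ∑∈-swap R S f = begin
    sum (λ i → ⟦ R i ⟧ * sum (λ j → ⟦ S j ⟧ * f i j))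
      ≡⟨ sum-cong-≗ (λ i → *-distribˡ-sum ⟦ R i ⟧ (λ j → ⟦ S j ⟧ * f i j)) ⟩
    sum (λ i → sum (λ j → ⟦ R i ⟧ * (⟦ S j ⟧ * f i j)))
      ≡⟨ ∑-comm (λ i j → ⟦ R i ⟧ * (⟦ S j ⟧ * f i j)) ⟩
    sum (λ j → sum (λ i → ⟦ R i ⟧ * (⟦ S j ⟧ * f i j)))
      ≡⟨ sum-cong-≗ (λ j → sum-cong-≗ λ i → exchange ⟦ R i ⟧ ⟦ S j ⟧ (f i j)) ⟩
    sum (λ j → sum (λ i → ⟦ S j ⟧ * (⟦ R i ⟧ * f i j)))
      ≡⟨ sum-cong-≗ (λ j → *-distribˡ-sum ⟦ S j ⟧ (λ i → ⟦ R i ⟧ * f i j)) ⟨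
    sum (λ j → ⟦ S j ⟧ * sum (λ i → ⟦ R i ⟧ * f i j)) ∎
    where
    open ≡-Reasoning
    exchange : ∀ x y z → x * (y * z) ≡ y * (x * z)
    exchange = solve-∀

  #-mono : ∀ {p} (P Q : VSet p) → P ⊑ Q → # P ≤ # Q
  #-mono P Q P⊑Q = sum-mono λ i → lemma (P i) (Q i) (P⊑Q i)
    where
    lemma : ∀ a b → (a ≡ true → b ≡ true) → ⟦ a ⟧ ≤ ⟦ b ⟧
    lemma false b     _   = z≤n
    lemma true  true  _   = s≤s z≤n
    lemma true  false a⇒b with () ← a⇒b refl

  #-cover : ∀ {p} (P Q R : VSet p) → P ⊑ Q ∪ R → # P ≤ # Q + # R
  #-cover P Q R P⊑ =
    subst (# P ≤_) (∑-distrib-+ (λ i → ⟦ Q i ⟧) (λ i → ⟦ R i ⟧))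
      (sum-mono λ i → lemma (P i) (Q i) (R i) (P⊑ i))
    where
    lemma : ∀ a b c → (a ≡ true → b ∨ c ≡ true) → ⟦ a ⟧ ≤ ⟦ b ⟧ + ⟦ c ⟧
    lemma false b     c     _ = z≤n
    lemma true  true  c     _ = s≤s z≤n
    lemma true  false true  _ = s≤s z≤n
    lemma true  false false a⇒ with () ← a⇒ refl

  #-pack : ∀ {p} (P Q R : VSet p) → Q ⊑ P → R ⊑ P →
           (∀ i → Q i ≡ true → R i ≡ true → ⊥) → # Q + # R ≤ # P
  #-pack P Q R Q⊑P R⊑P disjoint =
    subst (_≤ # P) (∑-distrib-+ (λ i → ⟦ Q i ⟧) (λ i → ⟦ R i ⟧))
      (sum-mono λ i → lemma (P i) (Q i) (R i) (Q⊑P i) (R⊑P i) (disjoint i))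
    where
    lemma : ∀ a b c → (b ≡ true → a ≡ true) → (c ≡ true → a ≡ true) →
            (b ≡ true → c ≡ true → ⊥) → ⟦ b ⟧ + ⟦ c ⟧ ≤ ⟦ a ⟧
    lemma a     false false _   _   _  = z≤n
    lemma true  true  false _   _   _  = s≤s z≤n
    lemma true  false true  _   _   _  = s≤s z≤n
    lemma a     true  true  _   _   bc = ⊥-elim (bc refl refl)
    lemma false true  false b⇒a _   _  with () ← b⇒a refl
    lemma false false true  _   c⇒a _  with () ← c⇒a refl

  indicator-split : ∀ {p} (S W : VSet p) → S ⊑ W → ∀ i → ⟦ W i ⟧ ≡ ⟦ S i ⟧ + ⟦ (W ∖ S) i ⟧
  indicator-split S W S⊑W i with S i | W i | S⊑W i
  ... | true  | true  | _   = refl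
  ... | true  | false | S⇒W with () ← S⇒W refl
  ... | false | true  | _   = refl
  ... | false | false | _   = refl

  ∑∈-split : ∀ {p} (S W : VSet p) → S ⊑ W → ∀ f → ∑∈ W f ≡ ∑∈ S f + ∑∈ (W ∖ S) f
  ∑∈-split S W S⊑W f = trans
    (sum-cong-≗ λ i → trans (cong (_* f i) (indicator-split S W S⊑W i))
                            (*-distribʳ-+ (f i) ⟦ S i ⟧ ⟦ (W ∖ S) i ⟧))
    (∑-distrib-+ (λ i → ⟦ S i ⟧ * f i) (λ i → ⟦ (W ∖ S) i ⟧ * f i))

  #-split : ∀ {p} (S W : VSet p) → S ⊑ W → # W ≡ # S + # (W ∖ S)
  #-split S W S⊑W = trans (sum-cong-≗ (indicator-split S W S⊑W))
    (∑-distrib-+ (λ i → ⟦ S i ⟧) (λ i → ⟦ (W ∖ S) i ⟧))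

  ∑∈-+ : ∀ {p} (S : VSet p) f g → ∑∈ S (λ i → f i + g i) ≡ ∑∈ S f + ∑∈ S g
  ∑∈-+ S f g = trans (sum-cong-≗ λ i → *-distribˡ-+ ⟦ S i ⟧ (f i) (g i))
    (∑-distrib-+ (λ i → ⟦ S i ⟧ * f i) (λ i → ⟦ S i ⟧ * g i))

  ∑∈-*ʳ : ∀ {p} (S : VSet p) f c → ∑∈ S (λ i → f i * c) ≡ ∑∈ S f * c
  ∑∈-*ʳ {zero}  S f c = refl
  ∑∈-*ʳ {suc p} S f c = trans
    (cong₂ _+_ (sym (*-assoc ⟦ S zero ⟧ (f zero) c)) (∑∈-*ʳ (λ i → S (suc i)) (λ i → f (suc i)) c))
    (sym (*-distribʳ-+ c (⟦ S zero ⟧ * f zero) _))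

  ∑∈-const : ∀ {p} (S : VSet p) c → ∑∈ S (λ _ → c) ≡ # S * c
  ∑∈-const {zero}  S c = refl
  ∑∈-const {suc p} S c = trans (cong (_+_ (⟦ S zero ⟧ * c)) (∑∈-const (λ i → S (suc i)) c))
    (sym (*-distribʳ-+ c ⟦ S zero ⟧ _))

  ∑∈-mono : ∀ {p} (S : VSet p) {f g : Fin p → ℕ} →
            (∀ i → S i ≡ true → f i ≤ g i) → ∑∈ S f ≤ ∑∈ S g
  ∑∈-mono S {f} {g} f≤g = sum-mono λ i → lemma (S i) (f≤g i)
    where
    lemma : ∀ b {x y} → (b ≡ true → x ≤ y) → ⟦ b ⟧ * x ≤ ⟦ b ⟧ * y
    lemma false _   = z≤n
    lemma true  x≤y = *-monoʳ-≤ 1 (x≤y refl)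

  #-∅ : ∀ {p} → # {p} (λ _ → false) ≡ 0
  #-∅ {zero}  = refl
  #-∅ {suc p} = #-∅ {p}

  #-full : ∀ {p} → # {p} (λ _ → true) ≡ p
  #-full {zero}  = refl
  #-full {suc p} = cong suc #-full

  #-single : ∀ {p} (x : Fin p) → # ｛ x ｝ ≡ 1
  #-single {suc p} zero    = cong suc (#-∅ {p})
  #-single {suc p} (suc x) = trans (sum-cong-≗ {p} λ i → refl) (#-single x)

  ∑∈-single : ∀ {p} (S : VSet p) {x} → S x ≡ true → ∑∈ S (λ i → ⟦ ｛ x ｝ i ⟧) ≡ 1
  ∑∈-single S {x} Sx = trans (sum-cong-≗ pointwise) (#-single x)
    where
    pointwise : ∀ i → ⟦ S i ⟧ * ⟦ ｛ x ｝ i ⟧ ≡ ⟦ ｛ x ｝ i ⟧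
    pointwise i with i Fin.≟ x
    ... | no  _    = *-zeroʳ ⟦ S i ⟧
    ... | yes refl rewrite Sx = refl

  #-insert : ∀ {p} (S : VSet p) {x} → S x ≡ false → # (S ∪ ｛ x ｝) ≡ suc (# S)
  #-insert S {x} Sx = trans (≤-antisym (#-cover (S ∪ ｛ x ｝) S ｛ x ｝ λ i z → z)
      (#-pack (S ∪ ｛ x ｝) S ｛ x ｝ (λ i Si → ∨-introˡ _ Si) (λ i → ∨-introʳ (S i)) disjoint))
    (trans (cong (_+_ (# S)) (#-single x)) (+-comm (# S) 1))
    where
    disjoint : ∀ i → S i ≡ true → ｛ x ｝ i ≡ true → ⊥
    disjoint i Si i≡x with refl ← single-elim {x = x} i i≡x = true≢false Si Sx

  select : ∀ {p} (P : VSet p) k → k ≤ # P → ∃[ Q ] (Q ⊑ P × # Q ≡ k)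
  select {zero}  P zero    _ = (λ _ → false) , (λ _ ()) , refl
  select {suc p} P k k≤ with P zero in eq
  ... | false with Q , Q⊑P , #Q ← select (λ i → P (suc i)) k k≤ =
    (λ { zero → false ; (suc i) → Q i }) , (λ { (suc i) → Q⊑P i }) , #Q
  select {suc p} P zero k≤ | true = (λ _ → false) , (λ _ ()) , #-∅ {p}
  select {suc p} P (suc k) (s≤s k≤) | true with Q , Q⊑P , #Q ← select (λ i → P (suc i)) k k≤ =
    (λ { zero → true ; (suc i) → Q i }) , (λ { zero _ → eq ; (suc i) → Q⊑P i }) , cong suc #Q

  -- The injection serves as a list of distinct leaves when the tree is embedded.
  enumerate : ∀ {p} (P : VSet p) k → k ≤ # P →
              ∃[ f ] (Injective _≡_ _≡_ f × ((i : Fin k) → P (f i) ≡ true))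
  enumerate {p}     P zero    _ = (λ ()) , (λ { {()} }) , λ ()
  enumerate {suc p} P (suc k) k≤ with P zero in eq
  ... | false with f , f-inj , Pf ← enumerate (λ i → P (suc i)) (suc k) k≤ =
    (λ i → suc (f i)) , (λ e → f-inj (Fin.suc-injective e)) , Pf
  enumerate {suc p} P (suc k) (s≤s k≤) | true with f , f-inj , Pf ← enumerate (λ i → P (suc i)) k k≤ =
    g , g-inj , Pg
    where
    g : Fin (suc k) → Fin (suc p)
    g zero    = zero
    g (suc i) = suc (f i)
    g-inj : Injective _≡_ _≡_ g
    g-inj {zero}  {zero}  _ = refl
    g-inj {suc i} {suc j} e = cong suc (f-inj (Fin.suc-injective e))
    Pg : ∀ i → P (g i) ≡ true
    Pg zero    = eq
    Pg (suc i) = Pf i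

  element : ∀ {p} (P : VSet p) → 1 ≤ # P → ∃[ x ] (P x ≡ true)
  element P 1≤ with f , _ , Pf ← enumerate P 1 1≤ = f zero , Pf zero

-- Degrees inside induced subgraphs.

module Degrees {p : ℕ} (a : Fin p → VSet p) (a-sym : ∀ i j → a i j ≡ a j i)
               (a-irr : ∀ i → a i i ≡ false) where

  -- Here `i` may lie outside `W`: for `i` in `S`, `deg (W ∖ S) i` counts the edges from `i` to the
  -- rest of `W`.
  deg : VSet p → Fin p → ℕ
  deg W i = # (W ∩ a i)

  degreeSum : VSet p → ℕ
  degreeSum W = ∑∈ W (deg W)

  N[_,_] : VSet p → Fin p → VSet p
  N[ W , u ] = W ∩ (｛ u ｝ ∪ a u)

  deg-mono : ∀ S W → S ⊑ W → ∀ i → deg S i ≤ deg W i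
  deg-mono S W S⊑W i = #-mono (S ∩ a i) (W ∩ a i) λ j Sj∧aij →
    let Sj , aij = ∧-elim (S j) Sj∧aij in ∧-intro (S⊑W j Sj) aij

  deg≡∑ : ∀ W i → deg W i ≡ ∑∈ W (λ j → ⟦ a i j ⟧)
  deg≡∑ W i = #-∩ W (a i)

  deg-split : ∀ S W → S ⊑ W → ∀ i → deg W i ≡ deg S i + deg (W ∖ S) i
  deg-split S W S⊑W i = trans (deg≡∑ W i) (trans
    (∑∈-split S W S⊑W (λ j → ⟦ a i j ⟧))
    (cong₂ _+_ (sym (deg≡∑ S i)) (sym (deg≡∑ (W ∖ S) i))))

  deg<# : ∀ W {v} → W v ≡ true → deg W v < # W
  deg<# W {v} Wv = subst (_≤ # W)
    (trans (cong (_+_ (deg W v)) (#-single v)) (+-comm (deg W v) 1))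
    (#-pack W (W ∩ a v) ｛ v ｝ (∩⊑ˡ W (a v))
      (λ i i≡v → subst (λ j → W j ≡ true) (sym (single-elim i i≡v)) Wv)
      λ i Wi∧avi i≡v → true≢false (proj₂ (∧-elim (W i) Wi∧avi))
        (subst (λ j → a v j ≡ false) (sym (single-elim i i≡v)) (a-irr v)))

  -- Row sums and column sums of the same block of the symmetric adjacency matrix.
  cross : ∀ R S → ∑∈ R (deg S) ≡ ∑∈ S (deg R)
  cross R S = begin
    ∑∈ R (deg S)                          ≡⟨ ∑∈-cong (deg≡∑ S) ⟩
    ∑∈ R (λ i → ∑∈ S (λ j → ⟦ a i j ⟧))   ≡⟨ ∑∈-swap R S (λ i j → ⟦ a i j ⟧) ⟩
    ∑∈ S (λ j → ∑∈ R (λ i → ⟦ a i j ⟧))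
      ≡⟨ ∑∈-cong (λ j → ∑∈-cong λ i → cong ⟦_⟧ (a-sym i j)) ⟩
    ∑∈ S (λ j → ∑∈ R (λ i → ⟦ a j i ⟧))   ≡⟨ ∑∈-cong (deg≡∑ R) ⟨
    ∑∈ S (deg R) ∎
    where open ≡-Reasoning

  -- An edge between `S` and the rest counts twice in `degreeSum W` but once in the sum of `deg W`
  -- over `S`. Doubling that sum also doubles the edges inside `S`, which the extra `degreeSum S` on
  -- the left balances without subtraction.
  degreeSum-split : ∀ S W → S ⊑ W →
    degreeSum W + degreeSum S ≡ 2 * ∑∈ S (deg W) + degreeSum (W ∖ S)
  degreeSum-split S W S⊑W = begin
    degreeSum W + degreeSum S
      ≡⟨ cong (_+ degreeSum S) (trans (∑∈-split S W S⊑W (deg W)) (cong₂ _+_ (over S) (over R))) ⟩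
    (degreeSum S + ∑∈ S (deg R)) + (∑∈ R (deg S) + degreeSum R) + degreeSum S
      ≡⟨ cong (λ x → (degreeSum S + ∑∈ S (deg R)) + (x + degreeSum R) + degreeSum S) (cross R S) ⟩
    (degreeSum S + ∑∈ S (deg R)) + (∑∈ S (deg R) + degreeSum R) + degreeSum S
      ≡⟨ rearrange (degreeSum S) (∑∈ S (deg R)) (degreeSum R) ⟩
    2 * (degreeSum S + ∑∈ S (deg R)) + degreeSum R
      ≡⟨ cong (λ x → 2 * x + degreeSum R) (over S) ⟨
    2 * ∑∈ S (deg W) + degreeSum R ∎
    where
    open ≡-Reasoning
    R = W ∖ S
    over : ∀ T → ∑∈ T (deg W) ≡ ∑∈ T (deg S) + ∑∈ T (deg R)
    over T = trans (∑∈-cong (deg-split S W S⊑W)) (∑∈-+ T (deg S) (deg R))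
    rearrange : ∀ x y z → (x + y) + (y + z) + x ≡ 2 * (x + y) + z
    rearrange = solve-∀

  #N : ∀ W {u} → W u ≡ true → # N[ W , u ] ≡ suc (deg W u)
  #N W {u} Wu = trans (#-cong λ j → lemma (W j) (｛ u ｝ j) (a u j) (u∈W j))
    (#-insert (W ∩ a u) (subst (λ b → W u ∧ b ≡ false) (sym (a-irr u)) (∧-false (W u))))
    where
    u∈W : ∀ j → ｛ u ｝ j ≡ true → W j ≡ true
    u∈W j j≡u = subst (λ i → W i ≡ true) (sym (single-elim j j≡u)) Wu
    lemma : ∀ b c d → (c ≡ true → b ≡ true) → b ∧ (c ∨ d) ≡ b ∧ d ∨ c
    lemma true  true  true  _ = refl
    lemma true  true  false _ = refl
    lemma true  false true  _ = refl
    lemma true  false false _ = refl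
    lemma false true  d     c⇒b = c⇒b refl
    lemma false false d     _ = refl

  N⊑ : ∀ W u → N[ W , u ] ⊑ W
  N⊑ W u = ∩⊑ˡ W (｛ u ｝ ∪ a u)

  ∈N : ∀ W {u} → W u ≡ true → N[ W , u ] u ≡ true
  ∈N W {u} Wu = ∧-intro Wu (∨-introˡ _ (∈-single u))

  nbr∈N : ∀ W {u v} → W v ≡ true → a u v ≡ true → N[ W , u ] v ≡ true
  nbr∈N W {u} {v} Wv auv = ∧-intro Wv (∨-introʳ (｛ u ｝ v) auv)

  deg-outside-N : ∀ W u → deg (W ∖ N[ W , u ]) u ≡ 0
  deg-outside-N W u = n≤0⇒n≡0 (subst (# ((W ∖ N[ W , u ]) ∩ a u) ≤_) (#-∅ {p})
    (#-mono ((W ∖ N[ W , u ]) ∩ a u) (λ _ → false) λ j e →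
      let W∖Nj , auj = ∧-elim ((W ∖ N[ W , u ]) j) e
          Wj , ¬Nj = ∧-elim (W j) W∖Nj
      in ⊥-elim (not-elim ¬Nj (nbr∈N W Wj auj))))

  -- Finding `suc L` vertices whose removal is cheap.

  module Reduction (L : ℕ) (8≤L : 8 ≤ L)
    (closed : ∀ W u v → W u ≡ true → W v ≡ true → a u v ≡ true →
              L ≤ 2 + deg W u → 4 ≤ deg W v → deg W u + deg (W ∖ N[ W , u ]) v ≤ L)
    where

    -- Splitting `deg W` into `deg S` and `deg (W ∖ S)` turns the inequality into: at most as many
    -- edges leave `S` as are missing inside `S`.
    Reducible : VSet p → Set
    Reducible W = ∃[ S ] (S ⊑ W × # S ≡ suc L × 2 * ∑∈ S (deg W) ≤ suc L * L + degreeSum S)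

    -- Discharging. A vertex `i` may overshoot its share of the inequality by `h i` if others
    -- undershoot theirs by `e`; summing over `S`, the total debt is covered by the total slack.
    reducible : ∀ W S (e h : Fin p → ℕ) → S ⊑ W → # S ≡ suc L →
      (∀ i → S i ≡ true → 2 * deg W i + e i ≤ L + deg S i + h i) →
      ∑∈ S h ≤ ∑∈ S e → Reducible W
    reducible W S e h S⊑W #S pointwise h≤e = S , S⊑W , #S , +-cancelʳ-≤ (∑∈ S e) _ _ (begin
      2 * ∑∈ S (deg W) + ∑∈ S e
        ≡⟨ cong (_+ ∑∈ S e) (trans (cong (_+_ (∑∈ S (deg W))) (+-identityʳ _)) (sym (∑∈-+ S (deg W) (deg W)))) ⟩
      ∑∈ S (λ i → deg W i + deg W i) + ∑∈ S e
        ≡⟨ ∑∈-+ S (λ i → deg W i + deg W i) e ⟨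
      ∑∈ S (λ i → deg W i + deg W i + e i)
        ≤⟨ ∑∈-mono S (λ i Si → subst (λ x → deg W i + x + e i ≤ L + deg S i + h i)
             (+-identityʳ (deg W i)) (pointwise i Si)) ⟩
      ∑∈ S (λ i → L + deg S i + h i)
        ≡⟨ trans (∑∈-+ S (λ i → L + deg S i) h) (cong (_+ ∑∈ S h) (∑∈-+ S (λ _ → L) (deg S))) ⟩
      ∑∈ S (λ _ → L) + degreeSum S + ∑∈ S h
        ≡⟨ cong (λ x → x + degreeSum S + ∑∈ S h) (trans (∑∈-const S L) (cong (_* L) #S)) ⟩
      suc L * L + degreeSum S + ∑∈ S h
        ≤⟨ +-monoʳ-≤ _ h≤e ⟩
      suc L * L + degreeSum S + ∑∈ S e ∎)
      where open ≤-Reasoning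

    reducible₀ : ∀ W S → S ⊑ W → # S ≡ suc L →
      (∀ i → S i ≡ true → 2 * deg W i ≤ L + deg S i) → Reducible W
    reducible₀ W S S⊑W #S pointwise =
      reducible W S (λ _ → 0) (λ _ → 0) S⊑W #S (λ i Si → +-monoˡ-≤ 0 (pointwise i Si)) ≤-refl

    -- Vertices of degree at most 3 meet their share outright, with 2 to spare, since 2 · 3 + 2 = 8.
    -- This is where `8 ≤ L` enters.
    2*low≤ : ∀ {d x} → d ≤ 3 → suc (suc (2 * d)) ≤ L + x
    2*low≤ {d} {x} d≤3 = ≤-trans (+-monoʳ-≤ 2 (*-monoʳ-≤ 2 d≤3)) (≤-trans 8≤L (m≤m+n L x))

    module _ (W : VSet p) (big : suc L ≤ # W) where

      low : VSet p
      low = W ∩ (λ i → deg W i ≤ᵇ 3)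

      low-elim : ∀ i → low i ≡ true → deg W i ≤ 3
      low-elim i e = ≤ᵇ⇒≤ (deg W i) 3 (subst Bool.T (sym (proj₂ (∧-elim (W i) e))) _)

      low-intro : ∀ i → W i ≡ true → deg W i ≤ 3 → low i ≡ true
      low-intro i Wi d≤3 with deg W i ≤ᵇ 3 | ≤⇒≤ᵇ d≤3
      ... | true | _ = ∧-intro Wi refl

      many-low : suc L ≤ # low → Reducible W
      many-low le with S , S⊑low , #S ← select low (suc L) le =
        reducible₀ W S (λ i Si → ∩⊑ˡ W (λ j → deg W j ≤ᵇ 3) i (S⊑low i Si)) #S
          λ i Si → ≤-trans (m≤n+m _ 2) (2*low≤ (low-elim i (S⊑low i Si)))

      module _ (few-low : ¬ suc L ≤ # low) where

        deg≤L : ∀ u → W u ≡ true → deg W u ≤ L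
        deg≤L u Wu with deg W u ≤? L
        ... | yes d≤L = d≤L
        ... | no  d≰L = contradiction
          (≤-trans (≰⇒> d≰L) (#-mono (W ∩ a u) low neighbours-low)) few-low
          where
          neighbours-low : W ∩ a u ⊑ low
          neighbours-low v e with ∧-elim (W v) e | deg W v ≤? 3
          ... | Wv , _   | yes d≤3 = low-intro v Wv d≤3
          -- A neighbour of degree at least 4 would bring `deg W u` back below `suc L` by `closed`.
          ... | Wv , auv | no  d≰3 = contradiction
            (≤-trans (m≤m+n _ _) (closed W u v Wu Wv auv
              (≤-trans (<⇒≤ (≰⇒> d≰L)) (m≤n+m _ 2)) (≰⇒> d≰3))) d≰L

        -- Extends `closed` from the neighbours of `u` to `u` itself, where the second summand
        -- vanishes and `deg≤L` is the bound.
        outside : ∀ u v → W u ≡ true → L ≤ 2 + deg W u → N[ W , u ] v ≡ true → 4 ≤ deg W v →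
                  deg W u + deg (W ∖ N[ W , u ]) v ≤ L
        outside u v Wu Lu Nv dv with ∧-elim (W v) Nv
        ... | Wv , e with ∨-elim (｛ u ｝ v) e
        ... | inj₂ auv = closed W u v Wu Wv auv Lu dv
        ... | inj₁ v≡u with refl ← single-elim v v≡u =
          subst (λ x → deg W u + x ≤ L) (sym (deg-outside-N W u))
            (subst (_≤ L) (sym (+-identityʳ _)) (deg≤L u Wu))

        -- When `deg W u = L`, `outside` leaves no room: a vertex of `N[ W , u ]` of degree at least
        -- 4 has all its neighbours in `S`, so `deg W` and `deg S` agree there.
        degree-L : ∀ u → W u ≡ true → deg W u ≡ L → Reducible W
        degree-L u Wu du = reducible₀ W S (N⊑ W u) (trans (#N W Wu) (cong suc du)) pointwise
          where
          S = N[ W , u ]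
          pointwise : ∀ i → S i ≡ true → 2 * deg W i ≤ L + deg S i
          pointwise i Si with deg W i ≤? 3
          ... | yes d≤3 = ≤-trans (m≤n+m _ 2) (2*low≤ d≤3)
          ... | no  d≰3 = +-mono-≤ (deg≤L i (N⊑ W u i Si)) (≤-reflexive (trans (+-identityʳ _)
            (trans (deg-split S W (N⊑ W u) i) (trans (cong (_+_ (deg S i)) out≡0) (+-identityʳ _)))))
            where
            out≡0 : deg (W ∖ S) i ≡ 0
            out≡0 = n≤0⇒n≡0 (+-cancelˡ-≤ L _ _ (subst₂ _≤_
              (cong (_+ deg (W ∖ S) i) du) (sym (+-identityʳ L))
              (outside u i Wu (≤-trans (≤-reflexive (sym du)) (m≤n+m _ 2)) Si (≰⇒> d≰3))))

        -- Maximum degree one below `L`.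

        module _ (deg<L : ∀ i → W i ≡ true → deg W i < L) (u : Fin p) (Wu : W u ≡ true)
                 (du : suc (deg W u) ≡ L) where

          private
            S = N[ W , u ]
            S⊑W = N⊑ W u
            #S : # S ≡ L
            #S = trans (#N W Wu) du
            L≤ : L ≤ 2 + deg W u
            L≤ = subst (_≤ 2 + deg W u) du (n≤1+n _)

          ∪⊑W : ∀ {y} → W y ≡ true → S ∪ ｛ y ｝ ⊑ W
          ∪⊑W {y} Wy i e with ∨-elim (S i) e
          ... | inj₁ Si = S⊑W i Si
          ... | inj₂ i≡y = subst (λ j → W j ≡ true) (sym (single-elim i i≡y)) Wy

          #∪ : ∀ {y} → S y ≡ false → # (S ∪ ｛ y ｝) ≡ suc L
          #∪ Sy = trans (#-insert S Sy) (cong suc #S)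

          not⇒false : ∀ {b} → not b ≡ true → b ≡ false
          not⇒false {false} _ = refl

          deg-grow : ∀ y i → deg S i ≤ deg (S ∪ ｛ y ｝) i
          deg-grow y i = deg-mono S (S ∪ ｛ y ｝) (λ j → ∨-introˡ _) i

          -- `S` has `L` vertices, one too few, so any further vertex `y` of `W` is added. Each
          -- vertex of `S` has at least one unit of slack, and these `L` units pay for `y`, which
          -- overshoots by less than `L` because its degree is below `L`.
          no-excess : (∀ i → S i ≡ true → 2 * deg W i < L + deg S i) → Reducible W
          no-excess pointwise with y , e ← element (W ∖ S) (+-cancelˡ-≤ L _ _
                 (subst₂ _≤_ (+-comm 1 L) (trans (#-split S W S⊑W) (cong (_+ # (W ∖ S)) #S)) big))
            with Wy , ¬Sy ← ∧-elim (W y) e =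
            reducible W S′ (λ _ → 1) (λ i → ⟦ ｛ y ｝ i ⟧ * L) (∪⊑W Wy) (#∪ (not⇒false ¬Sy)) pointwise′ total
            where
            S′ = S ∪ ｛ y ｝
            pointwise′ : ∀ i → S′ i ≡ true → 2 * deg W i + 1 ≤ L + deg S′ i + ⟦ ｛ y ｝ i ⟧ * L
            pointwise′ i S′i with ∨-elim (S i) S′i | deg<L i (∪⊑W Wy i S′i)
            ... | inj₁ Si | _ = ≤-trans (≤-reflexive (+-comm _ 1)) (≤-trans (pointwise i Si)
              (≤-trans (+-monoʳ-≤ L (deg-grow y i)) (m≤m+n _ _)))
            ... | inj₂ i≡y | d<L rewrite i≡y = begin
              2 * deg W i + 1
                ≡⟨ shift (deg W i) ⟩
              suc (deg W i) + deg W i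
                ≤⟨ +-mono-≤ d<L (<⇒≤ d<L) ⟩
              L + L
                ≤⟨ +-mono-≤ (m≤m+n L _) (≤-reflexive (sym (+-identityʳ L))) ⟩
              L + deg S′ i + (L + 0) ∎
              where
              open ≤-Reasoning
              shift : ∀ d → 2 * d + 1 ≡ suc d + d
              shift = solve-∀
            -- The debt is `L`, charged to `y` alone; the slack is 1 at each of the `suc L`
            -- vertices, `y` included.
            total : ∑∈ S′ (λ i → ⟦ ｛ y ｝ i ⟧ * L) ≤ ∑∈ S′ (λ _ → 1)
            total = begin
              ∑∈ S′ (λ i → ⟦ ｛ y ｝ i ⟧ * L)
                ≡⟨ trans (∑∈-*ʳ S′ (λ i → ⟦ ｛ y ｝ i ⟧) L)
                         (cong (_* L) (∑∈-single S′ (∨-introʳ (S y) (∈-single y)))) ⟩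
              1 * L
                ≤⟨ subst₂ _≤_ (sym (+-identityʳ L)) (sym (*-identityʳ (suc L))) (n≤1+n L) ⟩
              suc L * 1
                ≡⟨ trans (∑∈-const S′ 1) (cong (_* 1) (#∪ (not⇒false ¬Sy))) ⟨
              ∑∈ S′ (λ _ → 1) ∎
              where open ≤-Reasoning

          -- Here S = N[u] has size L, v sticks out of S by one vertex x, and S ∪ {x} works:
          -- x has at most two neighbours outside S, and its excess is paid for by u.
          excess : ∀ v → S v ≡ true → L + deg S v ≤ 2 * deg W v → Reducible W
          excess v Sv ex = let x , e = element ((W ∖ S) ∩ a v) 1≤out
                               W∖Sx , avx = ∧-elim ((W ∖ S) x) e
                               Wx , ¬Sx = ∧-elim (W x) W∖Sx
                           in absorb x Wx (not⇒false ¬Sx) avx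
            where
            Wv = S⊑W v Sv
            out : Fin p → ℕ
            out = deg (W ∖ S)
            deg≡ : ∀ i → deg W i ≡ deg S i + out i
            deg≡ = deg-split S W S⊑W
            -- One copy of `deg W v` in `ex` is split, and `deg S v` cancels.
            L≤d+out : L ≤ deg W v + out v
            L≤d+out = +-cancelʳ-≤ (deg S v) _ _ (≤-trans ex (≤-reflexive
              (trans (cong (λ x → deg W v + (x + 0)) (deg≡ v)) (rearrange (deg W v) (deg S v) (out v)))))
              where
              rearrange : ∀ x y z → x + (y + z + 0) ≡ x + z + y
              rearrange = solve-∀
            -- As `deg W u` is one below `L`, `outside` allows a single neighbour beyond `S`.
            out≤1 : ∀ i → S i ≡ true → ¬ deg W i ≤ 3 → out i ≤ 1
            out≤1 i Si d≰3 = +-cancelˡ-≤ (deg W u) _ _ (subst (deg W u + out i ≤_)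
              (trans (sym du) (+-comm 1 _)) (outside u i Wu L≤ Si (≰⇒> d≰3)))
            v-high : ¬ deg W v ≤ 3
            v-high d≤3 = <⇒≱ (≤-trans (n≤1+n _) (2*low≤ d≤3)) ex
            -- With `deg<L` this pins `deg W v` to `L ∸ 1`, so that `v` can take the role of `u` in
            -- `closed`.
            L≤1+dv : L ≤ deg W v + 1
            L≤1+dv = ≤-trans L≤d+out (+-monoʳ-≤ (deg W v) (out≤1 v Sv v-high))
            1≤out : 1 ≤ out v
            1≤out = +-cancelˡ-≤ (deg W v) _ _ (≤-trans
              (≤-reflexive (+-comm (deg W v) 1)) (≤-trans (deg<L v Wv) L≤d+out))
            absorb : ∀ x → W x ≡ true → S x ≡ false → a v x ≡ true → Reducible W
            absorb x Wx Sx avx = reducible W S′ (λ i → ⟦ ｛ u ｝ i ⟧) (λ i → ⟦ ｛ x ｝ i ⟧)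
              (∪⊑W Wx) (#∪ Sx) pointwise
              (≤-reflexive (trans (∑∈-single S′ (∨-introʳ (S x) (∈-single x)))
                                  (sym (∑∈-single S′ (∨-introˡ _ (∈N W Wu))))))
              where
              S′ = S ∪ ｛ x ｝
              -- A neighbour of `x` beyond `S` either lies outside `N[ W , v ]`, where `closed` for
              -- the edge from `v` to `x` permits one, or is a neighbour of `v` beyond `S`, of which
              -- there is at most one.
              out-x : ¬ deg W x ≤ 3 → out x ≤ 2
              out-x d≰3 = ≤-trans (#-cover ((W ∖ S) ∩ a x) ((W ∖ N[ W , v ]) ∩ a x) ((W ∖ S) ∩ a v) cover)
                (+-mono-≤ (+-cancelˡ-≤ (deg W v) _ 1 (≤-trans
                  (closed W v x Wv Wx avx (≤-trans L≤1+dv (≤-trans (≤-reflexive (+-comm _ 1)) (n≤1+n _)))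
                    (≰⇒> d≰3)) L≤1+dv))
                  (out≤1 v Sv v-high))
                where
                cover : (W ∖ S) ∩ a x ⊑ ((W ∖ N[ W , v ]) ∩ a x) ∪ ((W ∖ S) ∩ a v)
                cover j e with ∧-elim ((W ∖ S) j) e
                ... | W∖Sj , axj with ∧-elim (W j) W∖Sj | N[ W , v ] j in Nj
                ... | Wj , ¬Sj | false = ∨-introˡ _ (∧-intro (∧-intro Wj refl) axj)
                ... | Wj , ¬Sj | true with ∨-elim (｛ v ｝ j) (proj₂ (∧-elim (W j) Nj))
                ...   | inj₁ j≡v = ⊥-elim (not-elim ¬Sj (subst (λ i → S i ≡ true) (sym (single-elim j j≡v)) Sv))
                ...   | inj₂ avj = ∨-introʳ _ (∧-intro W∖Sj avj)
              2d≡ : ∀ i → 2 * deg W i ≡ deg W i + out i + deg S i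
              2d≡ i = trans (cong (λ y → deg W i + (y + 0)) (deg≡ i)) (rearrange (deg W i) (deg S i) (out i))
                where
                rearrange : ∀ x y z → x + (y + z + 0) ≡ x + z + y
                rearrange = solve-∀
              out-bound : ∀ i → S′ i ≡ true → ¬ deg W i ≤ 3 → deg W i + out i ≤ L + ⟦ ｛ x ｝ i ⟧
              out-bound i S′i d≰3 with ∨-elim (S i) S′i | deg<L i (∪⊑W Wx i S′i)
              ... | inj₁ Si  | d<L = ≤-trans (+-monoʳ-≤ (deg W i) (out≤1 i Si d≰3))
                (≤-trans (≤-reflexive (+-comm (deg W i) 1)) (≤-trans d<L (m≤m+n L _)))
              ... | inj₂ i≡x | d<L = subst (λ b → deg W i + out i ≤ L + ⟦ b ⟧) (sym i≡x)
                (≤-trans (+-monoʳ-≤ (deg W i)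
                           (subst (λ j → ¬ deg W j ≤ 3 → out j ≤ 2) (sym (single-elim i i≡x)) out-x d≰3))
                (≤-trans (≤-reflexive (+-suc (deg W i) 1)) (+-monoˡ-≤ 1 d<L)))
              high : ∀ i → S′ i ≡ true → ¬ deg W i ≤ 3 → 2 * deg W i + 0 ≤ L + deg S′ i + ⟦ ｛ x ｝ i ⟧
              high i S′i d≰3 = begin
                2 * deg W i + 0                  ≡⟨ trans (+-identityʳ _) (2d≡ i) ⟩
                deg W i + out i + deg S i        ≤⟨ +-mono-≤ (out-bound i S′i d≰3) (deg-grow x i) ⟩
                L + ⟦ ｛ x ｝ i ⟧ + deg S′ i     ≡⟨ rearrange L (deg S′ i) ⟦ ｛ x ｝ i ⟧ ⟩
                L + deg S′ i + ⟦ ｛ x ｝ i ⟧     ∎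
                where
                open ≤-Reasoning
                rearrange : ∀ x y z → x + z + y ≡ x + y + z
                rearrange = solve-∀
              pointwise : ∀ i → S′ i ≡ true →
                2 * deg W i + ⟦ ｛ u ｝ i ⟧ ≤ L + deg S′ i + ⟦ ｛ x ｝ i ⟧
              pointwise i S′i with deg W i ≤? 3 | high i S′i
              ... | yes d≤3 | _ = ≤-trans (+-monoʳ-≤ (2 * deg W i) (⟦⟧≤2 (｛ u ｝ i)))
                (≤-trans (≤-reflexive (+-comm _ 2)) (≤-trans (2*low≤ d≤3) (m≤m+n _ _)))
                where
                ⟦⟧≤2 : ∀ b → ⟦ b ⟧ ≤ 2
                ⟦⟧≤2 false = z≤n
                ⟦⟧≤2 true  = s≤s z≤n
              ... | no d≰3 | high-i with i Fin.≟ u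
              ...   | no _     = high-i d≰3
              -- `u` has no neighbour beyond `S` and degree `L ∸ 1`, so it has the unit of slack
              -- that `x` consumes.
              ...   | yes refl = begin
                2 * deg W u + 1           ≡⟨ cong (_+ 1) (2d≡ u) ⟩
                deg W u + out u + deg S u + 1
                  ≡⟨ cong (λ y → deg W u + y + deg S u + 1) (deg-outside-N W u) ⟩
                deg W u + 0 + deg S u + 1 ≡⟨ rearrange (deg W u) (deg S u) ⟩
                suc (deg W u) + deg S u   ≤⟨ +-mono-≤ (≤-reflexive du) (deg-grow x u) ⟩
                L + deg S′ u              ≤⟨ m≤m+n _ _ ⟩
                L + deg S′ u + ⟦ ｛ x ｝ u ⟧ ∎
                where
                open ≤-Reasoning
                rearrange : ∀ y z → y + 0 + z + 1 ≡ suc y + z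
                rearrange = solve-∀

        -- Degrees are at most `L` here; once the values `L` and `L ∸ 1` are excluded, all are at
        -- most `L ∸ 2`.
        reduce-few-low : (∀ i → W i ≡ true → 2 + deg W i ≤ L) ⊎ Reducible W
        reduce-few-low with Fin.any? (λ u → (W u Bool.≟ true) ×-dec (deg W u ≟ L))
        ... | yes (u , Wu , du) = inj₂ (degree-L u Wu du)
        ... | no no-L with Fin.any? (λ u → (W u Bool.≟ true) ×-dec (suc (deg W u) ≟ L))
        ... | no no-L-1 = inj₁ λ i Wi → ≤∧≢⇒< (≤∧≢⇒< (deg≤L i Wi) λ e → no-L (i , Wi , e))
                                               λ e → no-L-1 (i , Wi , e)
        ... | yes (u , Wu , du) with Fin.any? (λ v → (N[ W , u ] v Bool.≟ true) ×-dec
                                      (L + deg N[ W , u ] v ≤? 2 * deg W v))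
        ...   | yes (v , Sv , ex) = inj₂ (excess deg<L u Wu du v Sv ex)
          where
          deg<L : ∀ i → W i ≡ true → deg W i < L
          deg<L i Wi = ≤∧≢⇒< (deg≤L i Wi) λ e → no-L (i , Wi , e)
        ...   | no none = inj₂ (no-excess deg<L u Wu du λ i Si → ≰⇒> λ le → none (i , Si , le))
          where
          deg<L : ∀ i → W i ≡ true → deg W i < L
          deg<L i Wi = ≤∧≢⇒< (deg≤L i Wi) λ e → no-L (i , Wi , e)

      reduce : (∀ i → W i ≡ true → 2 + deg W i ≤ L) ⊎ Reducible W
      reduce with suc L ≤? # low
      ... | yes many = inj₂ (many-low many)
      ... | no  few  = reduce-few-low few

-- Embedding the tree around an edge.

witness : ∀ {P : Set} (P? : Dec P) → does P? ≡ true → P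
witness (yes p) _ = p

adjacency : ∀ {p} → Graph p → Fin p → VSet p
adjacency G i j = does (adj? G i j)

adjacency-sym : ∀ {p} (G : Graph p) i j → adjacency G i j ≡ adjacency G j i
adjacency-sym G i j = does-⇔ (mk⇔ (symmetric G) (symmetric G)) (adj? G i j) (adj? G j i)

adjacency-irr : ∀ {p} (G : Graph p) i → adjacency G i i ≡ false
adjacency-irr G i = dec-false (adj? G i i) (irreflexive G refl)

module _ {p : ℕ} (G : Graph p) (m : ℕ) (n≥6 : 10 + m ≥ 6) where
  private
    a = adjacency G

  open Degrees a (adjacency-sym G) (adjacency-irr G)

  -- `u` and `v` become v₀ and v₁; `A` supplies the `5 + m` leaves at v₀ and `B` the three leaves at
  -- v₁.
  embed : ∀ {u v} (A B : VSet p) → a u v ≡ true → 5 + m ≤ # A → 3 ≤ # B →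
          A ⊑ a u → B ⊑ a v → (∀ i → A i ≡ true → B i ≡ true → ⊥) →
          A v ≡ false → B u ≡ false → Contains G (T³ (10 + m) n≥6)
  embed {u} {v} A B auv #A #B A⊑ B⊑ disjoint v∉A u∉B = f , f-inj , f-adj
    where
    eA = enumerate A (5 + m) #A
    eB = enumerate B 3 #B
    g : Fin (5 + m) ⊎ Fin 3 → Fin p
    g (inj₁ i) = proj₁ eA i
    g (inj₂ i) = proj₁ eB i
    g∈A : ∀ i → A (g (inj₁ i)) ≡ true
    g∈A = proj₂ (proj₂ eA)
    g∈B : ∀ i → B (g (inj₂ i)) ≡ true
    g∈B = proj₂ (proj₂ eB)
    g-inj : ∀ s t → g s ≡ g t → s ≡ t
    g-inj (inj₁ i) (inj₁ j) e = cong inj₁ (proj₁ (proj₂ eA) e)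
    g-inj (inj₂ i) (inj₂ j) e = cong inj₂ (proj₁ (proj₂ eB) e)
    g-inj (inj₁ i) (inj₂ j) e = ⊥-elim (disjoint _ (g∈A i) (subst (λ x → B x ≡ true) (sym e) (g∈B j)))
    g-inj (inj₂ i) (inj₁ j) e = ⊥-elim (disjoint _ (g∈A j) (subst (λ x → B x ≡ true) e (g∈B i)))
    u≢v : u ≢ v
    u≢v refl = true≢false auv (adjacency-irr G u)
    g≢u : ∀ s → g s ≢ u
    g≢u (inj₁ i) e = true≢false (subst (λ x → a u x ≡ true) e (A⊑ _ (g∈A i))) (adjacency-irr G u)
    g≢u (inj₂ i) e = true≢false (subst (λ x → B x ≡ true) e (g∈B i)) u∉B
    g≢v : ∀ s → g s ≢ v
    g≢v (inj₁ i) e = true≢false (subst (λ x → A x ≡ true) e (g∈A i)) v∉A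
    g≢v (inj₂ i) e = true≢false (subst (λ x → a v x ≡ true) e (B⊑ _ (g∈B i))) (adjacency-irr G v)
    size : 8 + m ≡ (5 + m) + 3
    size = cong (_+_ 5) (+-comm 3 m)
    -- With v₀ and v₁ removed, the first `5 + m` indices are leaves at v₀ and the last three are
    -- leaves at v₁.
    side : Fin (8 + m) → Fin (5 + m) ⊎ Fin 3
    side j = Fin.splitAt (5 + m) (Fin.cast size j)
    side-inj : ∀ i j → side i ≡ side j → i ≡ j
    side-inj i j e = Fin.toℕ-injective (begin
      toℕ i                 ≡⟨ Fin.toℕ-cast size i ⟨
      toℕ (Fin.cast size i) ≡⟨ cong toℕ (trans (sym (Fin.join-splitAt (5 + m) 3 _))
                                (trans (cong (Fin.join (5 + m) 3) e) (Fin.join-splitAt (5 + m) 3 _))) ⟩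
      toℕ (Fin.cast size j) ≡⟨ Fin.toℕ-cast size j ⟩
      toℕ j                 ∎)
      where open ≡-Reasoning
    f : Fin (10 + m) → Fin p
    f zero          = u
    f (suc zero)    = v
    f (suc (suc j)) = g (side j)
    f-inj : Injective _≡_ _≡_ f
    f-inj {zero}        {zero}        e = refl
    f-inj {zero}        {suc zero}    e = contradiction e u≢v
    f-inj {zero}        {suc (suc j)} e = contradiction (sym e) (g≢u (side j))
    f-inj {suc zero}    {zero}        e = contradiction (sym e) u≢v
    f-inj {suc zero}    {suc zero}    e = refl
    f-inj {suc zero}    {suc (suc j)} e = contradiction (sym e) (g≢v (side j))
    f-inj {suc (suc i)} {zero}        e = contradiction e (g≢u (side i))
    f-inj {suc (suc i)} {suc zero}    e = contradiction e (g≢v (side i))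
    f-inj {suc (suc i)} {suc (suc j)} e =
      cong (λ k → suc (suc k)) (side-inj i j (g-inj (side i) (side j) e))
    f-edge : ∀ i j → T³-Edge (10 + m) i j → a (f i) (f j) ≡ true
    f-edge zero (suc zero)    (inj₁ _) = auv
    f-edge zero (suc (suc j)) (inj₁ (_ , _ , s≤s j<5+m))
      rewrite Fin.splitAt-< (5 + m) (Fin.cast size j) (subst (_< 5 + m) (sym (Fin.toℕ-cast size j)) j<5+m) =
      A⊑ _ (g∈A _)
    f-edge (suc zero) (suc zero)    (inj₂ (_ , s≤s () , _))
    f-edge (suc zero) (suc (suc j)) (inj₂ (_ , s≤s (s≤s 5+m≤j) , _))
      rewrite Fin.splitAt-≥ (5 + m) (Fin.cast size j) (subst (5 + m ≤_) (sym (Fin.toℕ-cast size j)) 5+m≤j) =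
      B⊑ _ (g∈B _)
    f-adj : ∀ {i j} → T³-Edge (10 + m) i j ⊎ T³-Edge (10 + m) j i → Adj G (f i) (f j)
    f-adj {i} {j} (inj₁ e) = witness (adj? G _ _) (f-edge i j e)
    f-adj {i} {j} (inj₂ e) = symmetric G (witness (adj? G _ _) (f-edge j i e))

  module _ (free : (T³ (10 + m) n≥6 Free) G) (W : VSet p) (u v : Fin p)
           (Wu : W u ≡ true) (Wv : W v ≡ true) (auv : a u v ≡ true)
           (du≥ : 8 + m ≤ 2 + deg W u) (dv≥ : 4 ≤ deg W v) where
    private
      -- `Q` holds the `o` private neighbours of `v`, `C` the common neighbours, and `Nu` the
      -- candidates for leaves at `u`.
      o  = deg (W ∖ N[ W , u ]) v
      Q  = (W ∖ N[ W , u ]) ∩ a v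
      C  = (W ∩ a u) ∩ a v
      Nu = (W ∩ a u) ∖ ｛ v ｝

      single⊑ : ｛ v ｝ ⊑ W ∩ a u
      single⊑ i i≡v = subst (λ j → (W ∩ a u) j ≡ true) (sym (single-elim i i≡v)) (∧-intro Wv auv)

      #Nu : deg W u ≡ suc (# Nu)
      #Nu = trans (#-split ｛ v ｝ (W ∩ a u) single⊑) (cong (_+ # Nu) (#-single v))

      Nu⊑ : Nu ⊑ a u
      Nu⊑ i e = proj₂ (∧-elim (W i) (proj₁ (∧-elim ((W ∩ a u) i) e)))

      v∉Nu : Nu v ≡ false
      v∉Nu = subst (λ b → (W ∩ a u) v ∧ not b ≡ false) (sym (∈-single v)) (∧-false ((W ∩ a u) v))

      Q∌nbr : ∀ i → Q i ≡ true → a u i ≡ true → ⊥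
      Q∌nbr i e aui =
        let W∖Ni , _ = ∧-elim ((W ∖ N[ W , u ]) i) e
            Wi , ¬Ni = ∧-elim (W i) W∖Ni
        in not-elim ¬Ni (nbr∈N W Wi aui)

      u∉Q : Q u ≡ false
      u∉Q = cong (_∧ a v u) (trans (cong (λ b → W u ∧ not b) (∈N W Wu)) (∧-false (W u)))

      Q⊑ : Q ⊑ a v
      Q⊑ i e = proj₂ (∧-elim ((W ∖ N[ W , u ]) i) e)

      -- `Q` alone serves `v`, so all of `Nu` stays available to `u`; it has `deg W u ∸ 1` vertices,
      -- at least `5 + m`.
      many-private : 3 ≤ o → ⊥
      many-private 3≤o = free (embed Nu Q auv
        (s≤s⁻¹ (subst (6 + m ≤_) #Nu (s≤s⁻¹ (s≤s⁻¹ du≥)))) 3≤o Nu⊑ Q⊑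
        (λ i Nui Qi → Q∌nbr i Qi (Nu⊑ i Nui)) v∉Nu u∉Q)

      -- Apart from `u`, every neighbour of `v` is private or common, and there are at least three
      -- of them.
      3∸o≤#C : 3 ∸ o ≤ # C
      3∸o≤#C = subst (3 ∸ o ≤_) (m+n∸m≡n o (# C)) (∸-monoˡ-≤ o (s≤s⁻¹ (begin
        4                               ≤⟨ dv≥ ⟩
        deg W v                         ≤⟨ #-cover (W ∩ a v) (Q ∪ C) ｛ u ｝ cover ⟩
        # (Q ∪ C) + # ｛ u ｝           ≤⟨ +-mono-≤ (#-cover (Q ∪ C) Q C (λ _ e → e)) (≤-reflexive (#-single u)) ⟩
        o + # C + 1                     ≡⟨ +-comm (o + # C) 1 ⟩
        suc (o + # C)                   ∎)))
        where
        open ≤-Reasoning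
        cover : W ∩ a v ⊑ (Q ∪ C) ∪ ｛ u ｝
        cover i = lemma (W i) (｛ u ｝ i) (a u i) (a v i)
          where
          lemma : ∀ w s b c → w ∧ c ≡ true → ((w ∧ not (w ∧ (s ∨ b))) ∧ c ∨ (w ∧ b) ∧ c) ∨ s ≡ true
          lemma true true  true  true _ = refl
          lemma true true  false true _ = refl
          lemma true false true  true _ = refl
          lemma true false false true _ = refl

      -- `Q` is topped up to three leaves by `3 ∸ o` common neighbours, which `u` then loses. What
      -- remains for `u` is (`deg W u` - 1) - (3 - `o`), at least 9 + `m` - 4.
      few-private : 8 + m < deg W u + o → o ≤ 3 → ⊥
      few-private d+o> o≤3 with C′ , C′⊑C , #C′ ← select C (3 ∸ o) 3∸o≤#C =
        free (embed A B auv #A #B (λ i e → Nu⊑ i (proj₁ (∧-elim (Nu i) e))) B⊑ disjoint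
          (cong (_∧ not (C′ v)) v∉Nu) u∉B)
        where
        A = Nu ∖ C′
        B = Q ∪ C′
        C⇒ : ∀ i → C i ≡ true → a u i ≡ true × a v i ≡ true
        C⇒ i e = let Wi∧aui , avi = ∧-elim ((W ∩ a u) i) e in proj₂ (∧-elim (W i) Wi∧aui) , avi
        B⊑ : B ⊑ a v
        B⊑ i e with ∨-elim (Q i) e
        ... | inj₁ Qi  = Q⊑ i Qi
        ... | inj₂ C′i = proj₂ (C⇒ i (C′⊑C i C′i))
        disjoint : ∀ i → A i ≡ true → B i ≡ true → ⊥
        disjoint i Ai Bi with ∧-elim (Nu i) Ai | ∨-elim (Q i) Bi
        ... | Nui , _    | inj₁ Qi  = Q∌nbr i Qi (Nu⊑ i Nui)
        ... | _   , ¬C′i | inj₂ C′i = not-elim ¬C′i C′i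
        u∉B : B u ≡ false
        u∉B = trans (cong (_∨ C′ u) u∉Q) u∉C′
          where
          u∉C′ : C′ u ≡ false
          u∉C′ with C′ u in C′u
          ... | false = refl
          ... | true  = ⊥-elim (true≢false (proj₁ (C⇒ u (C′⊑C u C′u))) (adjacency-irr G u))
        #B : 3 ≤ # B
        #B = begin
          3             ≡⟨ m+[n∸m]≡n o≤3 ⟨
          o + (3 ∸ o)   ≡⟨ cong (_+_ o) #C′ ⟨
          # Q + # C′    ≤⟨ #-pack B Q C′ (λ i → ∨-introˡ _) (λ i → ∨-introʳ (Q i))
                             (λ i Qi C′i → Q∌nbr i Qi (proj₁ (C⇒ i (C′⊑C i C′i)))) ⟩
          # B           ∎
          where open ≤-Reasoning
        #A : 5 + m ≤ # A
        #A = +-cancelˡ-≤ 4 _ _ (begin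
          9 + m                          ≤⟨ d+o> ⟩
          deg W u + o                    ≡⟨ cong (_+ o) #Nu ⟩
          suc (# Nu) + o                 ≤⟨ +-monoˡ-≤ o (s≤s (#-cover Nu C′ A cover)) ⟩
          suc (# C′ + # A) + o           ≡⟨ cong (λ x → suc (x + # A) + o) #C′ ⟩
          suc ((3 ∸ o) + # A) + o        ≡⟨ rearrange (3 ∸ o) (# A) o ⟩
          suc (o + (3 ∸ o)) + # A        ≡⟨ cong (λ x → suc x + # A) (m+[n∸m]≡n o≤3) ⟩
          4 + # A                        ∎)
          where
          open ≤-Reasoning
          rearrange : ∀ x y z → suc (x + y) + z ≡ suc (z + x) + y
          rearrange = solve-∀
          cover : Nu ⊑ C′ ∪ A
          cover i Nui with C′ i
          ... | true  = refl
          ... | false = ∧-intro Nui refl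

    -- The left side is the size of N(u) ∪ N(v) within `W`, with `u` itself left out.
    closed-neighbourhood : deg W u + o ≤ 8 + m
    closed-neighbourhood with deg W u + o ≤? 8 + m | ≤-total 3 o
    ... | yes le | _        = le
    ... | no _   | inj₁ 3≤o = ⊥-elim (many-private 3≤o)
    ... | no ¬le | inj₂ o≤3 = ⊥-elim (few-private (≰⇒> ¬le) o≤3)

-- The upper bound, by removing `suc L` vertices at a time.

module Induction {p : ℕ} (G : Graph p) (m : ℕ) (n≥6 : 10 + m ≥ 6)
                 (free : (T³ (10 + m) n≥6 Free) G) where
  private
    L = 8 + m

  open Degrees (adjacency G) (adjacency-sym G) (adjacency-irr G)
  open Reduction L (m≤m+n 8 m) (closed-neighbourhood G m n≥6 free)

  -- With N = `suc L`, the numerical hypothesis is r(N - r) ≤ 2(N + r) freed of subtraction. It is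
  -- what makes the bound hold when `reduce` finds only small degrees.
  bound : ∀ r → r * L ≤ 2 * suc L + r * (r ∸ 1) + 2 * r →
          ∀ k W → # W ≡ k * suc L + r → degreeSum W ≤ k * (suc L * L) + r * (r ∸ 1)
  bound r small zero W #W = begin
    degreeSum W               ≤⟨ ∑∈-mono W (λ i Wi → ∸-monoˡ-≤ 1 (subst (deg W i <_) #W (deg<# W Wi))) ⟩
    ∑∈ W (λ _ → r ∸ 1)        ≡⟨ ∑∈-const W (r ∸ 1) ⟩
    # W * (r ∸ 1)             ≡⟨ cong (_* (r ∸ 1)) #W ⟩
    r * (r ∸ 1)               ∎
    where open ≤-Reasoning
  bound r small (suc k) W #W with reduce W (subst (suc L ≤_) (sym #W)
                                   (≤-trans (m≤m+n (suc L) (k * suc L)) (m≤m+n _ r)))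
  -- Adding 2 at each vertex replaces the bound `L ∸ 2` on degrees by `L`.
  ... | inj₁ low-degrees = +-cancelʳ-≤ (2 * # W) _ _ (begin
    degreeSum W + 2 * # W
      ≡⟨ cong (_+_ (degreeSum W)) (trans (*-comm 2 (# W)) (sym (∑∈-const W 2))) ⟩
    degreeSum W + ∑∈ W (λ _ → 2)
      ≡⟨ ∑∈-+ W (deg W) (λ _ → 2) ⟨
    ∑∈ W (λ i → deg W i + 2)
      ≤⟨ ∑∈-mono W (λ i Wi → ≤-trans (≤-reflexive (+-comm (deg W i) 2)) (low-degrees i Wi)) ⟩
    ∑∈ W (λ _ → L)
      ≡⟨ ∑∈-const W L ⟩
    # W * L
      ≡⟨ cong (_* L) #W ⟩
    (suc k * suc L + r) * L
      ≡⟨ expand (suc k) (suc L) r L ⟩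
    suc k * (suc L * L) + r * L
      ≤⟨ +-monoʳ-≤ (suc k * (suc L * L)) small ⟩
    suc k * (suc L * L) + (2 * suc L + r * (r ∸ 1) + 2 * r)
      -- One block of `suc L` vertices already gives enough; the other `k` only add surplus.
      ≤⟨ m≤m+n _ (2 * (k * suc L)) ⟩
    suc k * (suc L * L) + (2 * suc L + r * (r ∸ 1) + 2 * r) + 2 * (k * suc L)
      ≡⟨ collect (suc k * (suc L * L)) (suc L) (r * (r ∸ 1)) r (k * suc L) ⟩
    suc k * (suc L * L) + r * (r ∸ 1) + 2 * (suc k * suc L + r)
      ≡⟨ cong (λ x → suc k * (suc L * L) + r * (r ∸ 1) + 2 * x) #W ⟨
    suc k * (suc L * L) + r * (r ∸ 1) + 2 * # W ∎)
    where
    open ≤-Reasoning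
    expand : ∀ k N r L → (k * N + r) * L ≡ k * (N * L) + r * L
    expand = solve-∀
    collect : ∀ x N y r z → x + (2 * N + y + 2 * r) + 2 * z ≡ x + y + 2 * ((N + z) + r)
    collect = solve-∀
  ... | inj₂ (S , S⊑W , #S , S-good) = +-cancelʳ-≤ (degreeSum S) _ _ (begin
    degreeSum W + degreeSum S
      ≡⟨ degreeSum-split S W S⊑W ⟩
    2 * ∑∈ S (deg W) + degreeSum (W ∖ S)
      ≤⟨ +-mono-≤ S-good (bound r small k (W ∖ S) #R) ⟩
    (suc L * L + degreeSum S) + (k * (suc L * L) + r * (r ∸ 1))
      ≡⟨ rearrange (suc L * L) (degreeSum S) (k * (suc L * L)) (r * (r ∸ 1)) ⟩
    suc L * L + k * (suc L * L) + r * (r ∸ 1) + degreeSum S ∎)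
    where
    open ≤-Reasoning
    rearrange : ∀ x y z w → (x + y) + (z + w) ≡ x + z + w + y
    rearrange = solve-∀
    #R : # (W ∖ S) ≡ k * suc L + r
    #R = +-cancelˡ-≡ (suc L) _ _ (trans (cong (_+ # (W ∖ S)) (sym #S))
      (trans (sym (#-split S W S⊑W)) (trans #W (+-assoc (suc L) (k * suc L) r))))

-- Edge counts and degree sums.

full : ∀ {p} → VSet p
full _ = true

opaque
  unfolding #

  length-filter-tabulate : ∀ {n} {A : Set} {P : Pred A 0ℓ} (P? : Decidable P) (f : Fin n → A) →
    length (filter P? (tabulate f)) ≡ # (λ i → does (P? (f i)))
  length-filter-tabulate {zero}  P? f = refl
  length-filter-tabulate {suc n} P? f with does (P? (f zero))
  ... | false = length-filter-tabulate P? (λ i → f (suc i))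
  ... | true  = cong suc (length-filter-tabulate P? (λ i → f (suc i)))

length-filter-product : ∀ {n m} {A : Set} {P : Pred (A × Fin m) 0ℓ} (P? : Decidable P) (f : Fin n → A) →
  length (filter P? (cartesianProduct (tabulate f) (allFin m))) ≡
  sum (λ i → # (λ j → does (P? (f i , j))))
length-filter-product {zero}          P? f = refl
length-filter-product {suc n} {m = m} P? f = begin
  length (filter P? (map (f zero ,_) (allFin m) ++ rest))
    ≡⟨ cong length (filter-++ P? (map (f zero ,_) (allFin m)) rest) ⟩
  length (filter P? (map (f zero ,_) (allFin m)) ++ filter P? rest)
    ≡⟨ length-++ (filter P? (map (f zero ,_) (allFin m))) ⟩
  length (filter P? (map (f zero ,_) (allFin m))) + length (filter P? rest)
    ≡⟨ cong₂ _+_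
         (trans (cong (λ xs → length (filter P? xs)) (map-tabulate id (f zero ,_)))
                (length-filter-tabulate P? (f zero ,_)))
         (length-filter-product P? (λ i → f (suc i))) ⟩
  sum (λ i → # (λ j → does (P? (f i , j)))) ∎
  where
  open ≡-Reasoning
  rest = cartesianProduct (tabulate (λ i → f (suc i))) (allFin m)

module _ {p : ℕ} (G : Graph p) where
  private
    a = adjacency G

  open Degrees a (adjacency-sym G) (adjacency-irr G)

  -- Each degree splits into larger and smaller neighbours. The larger ones sum to `edgeCount G`,
  -- and by symmetry of adjacency so do the smaller ones.
  handshake : degreeSum full ≡ 2 * edgeCount G
  handshake = begin
    ∑∈ full (deg full)                ≡⟨ ∑∈-cong up+down ⟩
    ∑∈ full (λ i → # (up i) + # (down i))
      ≡⟨ ∑∈-+ full (λ i → # (up i)) (λ i → # (down i)) ⟩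
    ∑∈ full (λ i → # (up i)) + ∑∈ full (λ i → # (down i))
      ≡⟨ cong₂ _+_ ∑up (trans ∑down (trans ∑up (sym (+-identityʳ _)))) ⟩
    2 * edgeCount G                   ∎
    where
    open ≡-Reasoning
    up down : Fin p → VSet p
    up   i j = does (i Fin.<? j) ∧ a i j
    down i j = does (j Fin.<? i) ∧ a i j
    up+down : ∀ i → deg full i ≡ # (up i) + # (down i)
    up+down i = ≤-antisym (#-cover (a i) (up i) (down i) cover)
      (#-pack (a i) (up i) (down i) (λ j e → proj₂ (∧-elim (does (i Fin.<? j)) e))
        (λ j e → proj₂ (∧-elim (does (j Fin.<? i)) e)) disjoint)
      where
      cover : a i ⊑ up i ∪ down i
      cover j aij with Fin.<-cmp i j
      ... | tri< i<j _ _ = ∨-introˡ _ (∧-intro (dec-true (i Fin.<? j) i<j) aij)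
      ... | tri> _ _ j<i = ∨-introʳ (up i j) (∧-intro (dec-true (j Fin.<? i) j<i) aij)
      ... | tri≈ _ refl _ = ⊥-elim (true≢false aij (adjacency-irr G i))
      disjoint : ∀ j → up i j ≡ true → down i j ≡ true → ⊥
      disjoint j u d = <-asym
        (witness (i Fin.<? j) (proj₁ (∧-elim (does (i Fin.<? j)) u)))
        (witness (j Fin.<? i) (proj₁ (∧-elim (does (j Fin.<? i)) d)))
    ∑up : ∑∈ full (λ i → # (up i)) ≡ edgeCount G
    ∑up = trans (∑∈-full (λ i → # (up i))) (sym (length-filter-product
      (λ (i , j) → (i Fin.<? j) ×-dec adj? G i j) id))
    ∑down : ∑∈ full (λ i → # (down i)) ≡ ∑∈ full (λ i → # (up i))
    ∑down = begin
      ∑∈ full (λ i → # (down i))                     ≡⟨ ∑∈-cong (λ i → #-∩ full (down i)) ⟩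
      ∑∈ full (λ i → ∑∈ full (λ j → ⟦ down i j ⟧))   ≡⟨ ∑∈-swap full full (λ i j → ⟦ down i j ⟧) ⟩
      ∑∈ full (λ j → ∑∈ full (λ i → ⟦ down i j ⟧))
        ≡⟨ ∑∈-cong (λ j → ∑∈-cong λ i → cong (λ b → ⟦ does (j Fin.<? i) ∧ b ⟧) (adjacency-sym G i j)) ⟩
      ∑∈ full (λ j → ∑∈ full (λ i → ⟦ up j i ⟧))     ≡⟨ ∑∈-cong (λ i → #-∩ full (up i)) ⟨
      ∑∈ full (λ i → # (up i))                       ∎

-- The extremal graph: disjoint cliques.

sum-const : ∀ n c → sum {n} (λ _ → c) ≡ n * c
sum-const zero    c = refl
sum-const (suc n) c = cong (_+_ c) (sum-const n c)

sum-toℕ-+ : ∀ m {n} (f : ℕ → ℕ) →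
  sum {m + n} (λ i → f (toℕ i)) ≡ sum {m} (λ i → f (toℕ i)) + sum {n} (λ i → f (m + toℕ i))
sum-toℕ-+ zero        f = refl
sum-toℕ-+ (suc m) {n} f = trans (cong (_+_ (f 0)) (sum-toℕ-+ m {n} (λ x → f (suc x))))
  (sym (+-assoc (f 0) _ _))

module Cliques (L : ℕ) where
  private
    N = suc L

  -- The quotient by `N` names the clique; for `p = k * N + r` with `r ≤ N` this is `k` copies of
  -- K_N and one K_r.
  cliques : ∀ p → Graph p
  cliques p = record
    { Adj         = λ i j → toℕ i ℕ./ N ≡ toℕ j ℕ./ N × i ≢ j
    ; adj?        = λ i j → (toℕ i ℕ./ N ≟ toℕ j ℕ./ N) ×-dec ¬? (i Fin.≟ j)
    ; symmetric   = λ (e , i≢j) → sym e , λ j≡i → i≢j (sym j≡i)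
    ; irreflexive = λ i≡j (_ , i≢j) → i≢j i≡j
    }

  -- The tree is connected, so its image has a single quotient by `N`. It has N + 1 vertices, so two
  -- of them share a remainder as well and coincide.
  cliques-free : ∀ {p} m (n≥6 : 10 + m ≥ 6) → 8 + m ≡ L → (T³ (10 + m) n≥6 Free) (cliques p)
  cliques-free m n≥6 refl (f , f-inj , f-adj)
    with i , j , i<j , e ← Fin.pigeonhole (n<1+n N) (λ i → Fin.fromℕ< (m%n<n (toℕ (f i)) N)) =
    <⇒≢ i<j (cong toℕ (f-inj (Fin.toℕ-injective (begin
      toℕ (f i)                                     ≡⟨ m≡m%n+[m/n]*n (toℕ (f i)) N ⟩
      toℕ (f i) ℕ.% N + toℕ (f i) ℕ./ N * N
        ≡⟨ cong₂ (λ x y → x + y * N) same-remainder (trans (block i) (sym (block j))) ⟩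
      toℕ (f j) ℕ.% N + toℕ (f j) ℕ./ N * N             ≡⟨ m≡m%n+[m/n]*n (toℕ (f j)) N ⟨
      toℕ (f j)                                     ∎))))
    where
    open ≡-Reasoning
    same-remainder : toℕ (f i) ℕ.% N ≡ toℕ (f j) ℕ.% N
    same-remainder = trans (sym (Fin.toℕ-fromℕ< _)) (trans (cong toℕ e) (Fin.toℕ-fromℕ< _))
    leaf : ∀ u v → T³-Edge (10 + m) u v → toℕ (f v) ℕ./ N ≡ toℕ (f u) ℕ./ N
    leaf u v uv = sym (proj₁ (f-adj (inj₁ uv)))
    block : ∀ i → toℕ (f i) ℕ./ N ≡ toℕ (f zero) ℕ./ N
    block zero = refl
    -- Indices up to `6 + m` are adjacent to v₀; the others are reached through v₁.
    block (suc i) with toℕ (suc i) ≤? 6 + m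
    ... | yes i≤ = leaf zero (suc i) (inj₁ (refl , s≤s z≤n , i≤))
    ... | no  i≰ = trans
      (leaf (suc zero) (suc i) (inj₂ (refl , ≰⇒> i≰ , s≤s⁻¹ (Fin.toℕ<n (suc i)))))
      (leaf zero (suc zero) (inj₁ (refl , s≤s z≤n , s≤s z≤n)))

  sameBlock : ℕ → ℕ → Bool
  sameBlock x y = does (x ℕ./ N ≟ y ℕ./ N)

  -- Ordered pairs with the diagonal included, so that a block of size s contributes s².
  pairs : ℕ → ℕ
  pairs p = sum {p} (λ i → sum {p} (λ j → ⟦ sameBlock (toℕ i) (toℕ j) ⟧))

  shift : ∀ x → (N + x) ℕ./ N ≡ suc (x ℕ./ N)
  shift x = trans (m/n≡1+[m∸n]/n (m≤m+n N x)) (cong (λ y → suc (y ℕ./ N)) (m+n∸m≡n N x))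

  sameBlock-first : ∀ {x y} → x < N → y < N → sameBlock x y ≡ true
  sameBlock-first x<N y<N = dec-true (_ ≟ _) (trans (m<n⇒m/n≡0 x<N) (sym (m<n⇒m/n≡0 y<N)))

  sameBlock-shift : ∀ x y → sameBlock (N + x) (N + y) ≡ sameBlock x y
  sameBlock-shift x y rewrite shift x | shift y = refl

  sameBlock-first-later : ∀ {x} y → x < N → sameBlock x (N + y) ≡ false
  sameBlock-first-later y x<N rewrite m<n⇒m/n≡0 x<N | shift y = refl

  sameBlock-later-first : ∀ x {y} → y < N → sameBlock (N + x) y ≡ false
  sameBlock-later-first x y<N rewrite m<n⇒m/n≡0 y<N | shift x = refl

  pairs-small : ∀ {r} → r ≤ N → pairs r ≡ r * r
  pairs-small {r} r≤N = trans
    (sum-cong-≗ λ i → trans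
      (sum-cong-≗ λ j → cong ⟦_⟧
        (sameBlock-first (<-≤-trans (Fin.toℕ<n i) r≤N) (<-≤-trans (Fin.toℕ<n j) r≤N)))
      (trans (sum-const r 1) (*-identityʳ r)))
    (sum-const r r)

  -- A new first block shifts later quotients by one. Its own rows sum to `N` each, and no pair
  -- crosses between it and the later vertices.
  pairs-+ : ∀ q → pairs (N + q) ≡ N * N + pairs q
  pairs-+ q = trans (sum-toℕ-+ N {q} row) (cong₂ _+_
    (trans (sum-cong-≗ {N} {λ i → row (toℕ i)} {λ _ → N} (λ i → first (toℕ i) (Fin.toℕ<n i))) (sum-const N N))
    (sum-cong-≗ {q} {λ i → row (N + toℕ i)} {λ i → sum {q} (λ j → ⟦ sameBlock (toℕ i) (toℕ j) ⟧)}
      (λ i → later (toℕ i))))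
    where
    row : ℕ → ℕ
    row x = sum {N + q} (λ j → ⟦ sameBlock x (toℕ j) ⟧)
    row-split : ∀ x → row x ≡
      sum {N} (λ j → ⟦ sameBlock x (toℕ j) ⟧) + sum {q} (λ j → ⟦ sameBlock x (N + toℕ j) ⟧)
    row-split x = sum-toℕ-+ N {q} (λ y → ⟦ sameBlock x y ⟧)
    first : ∀ x → x < N → row x ≡ N
    first x x<N = begin
      row x        ≡⟨ row-split x ⟩
      sum {N} (λ j → ⟦ sameBlock x (toℕ j) ⟧) + sum {q} (λ j → ⟦ sameBlock x (N + toℕ j) ⟧)
        ≡⟨ cong₂ _+_
             (sum-cong-≗ {N} {λ j → ⟦ sameBlock x (toℕ j) ⟧} {λ _ → 1}
               λ j → cong ⟦_⟧ (sameBlock-first x<N (Fin.toℕ<n j)))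
             (sum-cong-≗ {q} {λ j → ⟦ sameBlock x (N + toℕ j) ⟧} {λ _ → 0}
               λ j → cong ⟦_⟧ (sameBlock-first-later (toℕ j) x<N)) ⟩
      sum {N} (λ _ → 1) + sum {q} (λ _ → 0)
        ≡⟨ cong₂ _+_ (trans (sum-const N 1) (*-identityʳ N)) (trans (sum-const q 0) (*-zeroʳ q)) ⟩
      N + 0        ≡⟨ +-identityʳ N ⟩
      N            ∎
      where open ≡-Reasoning
    later : ∀ x → row (N + x) ≡ sum {q} (λ j → ⟦ sameBlock x (toℕ j) ⟧)
    later x = begin
      row (N + x)  ≡⟨ row-split (N + x) ⟩
      sum {N} (λ j → ⟦ sameBlock (N + x) (toℕ j) ⟧) + sum {q} (λ j → ⟦ sameBlock (N + x) (N + toℕ j) ⟧)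
        ≡⟨ cong₂ _+_
             (sum-cong-≗ {N} {λ j → ⟦ sameBlock (N + x) (toℕ j) ⟧} {λ _ → 0}
               λ j → cong ⟦_⟧ (sameBlock-later-first x (Fin.toℕ<n j)))
             (sum-cong-≗ {q} {λ j → ⟦ sameBlock (N + x) (N + toℕ j) ⟧}
               {λ j → ⟦ sameBlock x (toℕ j) ⟧} λ j → cong ⟦_⟧ (sameBlock-shift x (toℕ j))) ⟩
      sum {N} (λ _ → 0) + sum {q} (λ j → ⟦ sameBlock x (toℕ j) ⟧)
        ≡⟨ cong (_+ sum {q} (λ j → ⟦ sameBlock x (toℕ j) ⟧)) (trans (sum-const N 0) (*-zeroʳ N)) ⟩
      sum {q} (λ j → ⟦ sameBlock x (toℕ j) ⟧) ∎
      where open ≡-Reasoning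

  pairs-total : ∀ k {r} → r ≤ N → pairs (k * N + r) ≡ k * (N * N) + r * r
  pairs-total zero        r≤N = pairs-small r≤N
  pairs-total (suc k) {r} r≤N = begin
    pairs (N + k * N + r)          ≡⟨ cong pairs (+-assoc N (k * N) r) ⟩
    pairs (N + (k * N + r))        ≡⟨ pairs-+ (k * N + r) ⟩
    N * N + pairs (k * N + r)      ≡⟨ cong (_+_ (N * N)) (pairs-total k r≤N) ⟩
    N * N + (k * (N * N) + r * r)  ≡⟨ +-assoc (N * N) (k * (N * N)) (r * r) ⟨
    suc k * (N * N) + r * r        ∎
    where open ≡-Reasoning

  -- Adding 1 at each vertex restores the diagonal and turns degrees into block sizes, so
  -- `pairs-total` applies.
  edges : ∀ k {r} → r ≤ N → 2 * edgeCount (cliques (k * N + r)) ≡ k * (N * L) + r * (r ∸ 1)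
  edges k {r} r≤N = +-cancelʳ-≡ p _ _ (begin
    2 * edgeCount G + p           ≡⟨ cong₂ _+_ (sym (handshake G)) p≡ ⟩
    degreeSum full + ∑∈ full (λ _ → 1) ≡⟨ ∑∈-+ full (deg full) (λ _ → 1) ⟨
    ∑∈ full (λ i → deg full i + 1)     ≡⟨ ∑∈-full (λ i → deg full i + 1) ⟩
    sum (λ i → deg full i + 1)         ≡⟨ sum-cong-≗ class ⟩
    pairs p                            ≡⟨ pairs-total k r≤N ⟩
    k * (N * N) + r * r                ≡⟨ expand r ⟩
    k * (N * L) + r * (r ∸ 1) + p ∎)
    where
    open ≡-Reasoning
    p = k * N + r
    G = cliques p
    open Degrees (adjacency G) (adjacency-sym G) (adjacency-irr G)
    p≡ : p ≡ ∑∈ full (λ _ → 1)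
    p≡ = sym (trans (∑∈-full {p} (λ _ → 1)) (trans (sum-const p 1) (*-identityʳ p)))
    class : ∀ (i : Fin p) → deg full i + 1 ≡ sum {p} (λ j → ⟦ sameBlock (toℕ i) (toℕ j) ⟧)
    class i = begin
      deg full i + 1                 ≡⟨ cong (_+_ (deg full i)) (#-single i) ⟨
      # (adjacency G i) + # ｛ i ｝  ≡⟨ ≤-antisym
        (#-pack block (adjacency G i) ｛ i ｝ (λ j e → proj₁ (∧-elim (block j) e))
          (λ j j≡i → dec-true (toℕ i ℕ./ N ≟ toℕ j ℕ./ N)
            (cong (λ x → toℕ x ℕ./ N) (sym (single-elim j j≡i))))
          (λ j e j≡i → true≢false e
            (subst (λ x → adjacency G i x ≡ false) (sym (single-elim j j≡i)) (adjacency-irr G i))))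
        (#-cover block (adjacency G i) ｛ i ｝ cover) ⟩
      # block                        ≡⟨ #≡sum block ⟩
      sum {p} (λ j → ⟦ block j ⟧)    ∎
      where
      block : VSet p
      block j = sameBlock (toℕ i) (toℕ j)
      cover : block ⊑ adjacency G i ∪ ｛ i ｝
      cover j e with j Fin.≟ i
      ... | yes _   = ∨-introʳ (adjacency G i j) refl
      ... | no  j≢i = ∨-introˡ _ (∧-intro e (not-intro (dec-false (i Fin.≟ j) (λ i≡j → j≢i (sym i≡j)))))
    expand : ∀ r → k * (N * N) + r * r ≡ k * (N * L) + r * (r ∸ 1) + (k * N + r)
    expand zero    = identity k L
      where
      identity : ∀ k L → k * (suc L * suc L) + 0 ≡ k * (suc L * L) + 0 + (k * suc L + 0)
      identity = solve-∀
    expand (suc r) = identity k L r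
      where
      identity : ∀ k L r → k * (suc L * suc L) + suc r * suc r ≡
                 k * (suc L * L) + suc r * r + (k * suc L + suc r)
      identity = solve-∀

-- Arithmetic of the closed formula.

half : ∀ e → (+ e) / 1 ≡ (+ (2 * e)) / 2
half e = fromℚᵘ-cong {mkℚᵘ (+ e) 0} {mkℚᵘ (+ (2 * e)) 1} (*≡* (begin
  + e ℤ.* + 2       ≡⟨ ℤ.pos-* e 2 ⟨
  + (e * 2)         ≡⟨ cong +_ (trans (*-comm e 2) (sym (*-identityʳ (2 * e)))) ⟩
  + (2 * e * 1)     ≡⟨ ℤ.pos-* (2 * e) 1 ⟩
  + (2 * e) ℤ.* + 1 ∎))
  where open ≡-Reasoning

-- With L = `8 + m` and N = `9 + m`, L · (kN + r) exceeds 2e by r(N - r); `r ≤ 9 + m` lets the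
-- integer differences be taken in the naturals.
formula : ∀ m k r e → r ≤ 9 + m → 2 * e ≡ k * ((9 + m) * (8 + m)) + r * (r ∸ 1) →
  (+ (8 + m)) ℤ.* + (k * (9 + m) + r) ℤ.- + r ℤ.* (+ (9 + m) ℤ.- + r) ≡ + (2 * e)
formula m k r e r≤N 2e = begin
  + L ℤ.* + p ℤ.- + r ℤ.* (+ N ℤ.- + r)
    ≡⟨ cong₂ (λ x y → x ℤ.- + r ℤ.* y) (sym (ℤ.pos-* L p)) (trans (ℤ.m-n≡m⊖n N r) (ℤ.⊖-≥ r≤N)) ⟩
  + (L * p) ℤ.- + r ℤ.* + (N ∸ r)   ≡⟨ cong (λ x → + (L * p) ℤ.- x) (ℤ.pos-* r (N ∸ r)) ⟨
  + (L * p) ℤ.- + (r * (N ∸ r)) 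
    ≡⟨ cong (λ x → + x ℤ.- + (r * (N ∸ r)))
         (trans (split r (N ∸ r) (m+[n∸m]≡n r≤N)) (cong (_+ r * (N ∸ r)) (sym 2e))) ⟩
  + (2 * e + r * (N ∸ r)) ℤ.- + (r * (N ∸ r)) ≡⟨ ℤ.m-n≡m⊖n (2 * e + r * (N ∸ r)) (r * (N ∸ r)) ⟩
  (2 * e + r * (N ∸ r)) ℤ.⊖ (r * (N ∸ r))     ≡⟨ ℤ.⊖-≥ (m≤n+m (r * (N ∸ r)) (2 * e)) ⟩
  + (2 * e + r * (N ∸ r) ∸ r * (N ∸ r))       ≡⟨ cong +_ (m+n∸n≡m (2 * e) (r * (N ∸ r))) ⟩
  + (2 * e) ∎
  where
  open ≡-Reasoning
  L = 8 + m
  N = 9 + m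
  p = k * N + r
  -- The case distinction removes `r ∸ 1`; for positive `r` it gives L = (r - 1) + s.
  split : ∀ r s → r + s ≡ N → L * (k * N + r) ≡ k * (N * L) + r * (r ∸ 1) + r * s
  split zero    s _ = identity k N L
    where
    identity : ∀ k N L → L * (k * N + 0) ≡ k * (N * L) + 0 + 0
    identity = solve-∀
  split (suc r) s r+s = subst (λ l → l * (k * N + suc r) ≡ k * (N * l) + suc r * r + suc r * s)
    (suc-injective r+s) (identity k N r s)
    where
    identity : ∀ k N r s → (r + s) * (k * N + suc r) ≡ k * (N * (r + s)) + suc r * r + suc r * s
    identity = solve-∀

-- Each case names the exact slack in the inequality as the second argument of `m≤m+n`, except
-- `r = 0`. The tightest are `r = 2` and `r = n ∸ 5`, with slack 8.
admissible : ∀ m r → let n = 10 + m ; L = 8 + m in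
  r ∈ (0 ∷ 1 ∷ 2 ∷ n ∸ 5 ∷ n ∸ 4 ∷ n ∸ 3 ∷ n ∸ 2 ∷ []) →
  r ≤ suc L × r * L ≤ 2 * suc L + r * (r ∸ 1) + 2 * r
admissible m r (here refl) = z≤n , z≤n
admissible m r (there (here refl)) = s≤s z≤n ,
  ≤-trans (m≤m+n _ (12 + m)) (≤-reflexive (identity m))
  where
  identity : ∀ m → 1 * (8 + m) + (12 + m) ≡ 2 * (9 + m) + 0 + 2
  identity = solve-∀
admissible m r (there (there (here refl))) = s≤s (s≤s z≤n) ,
  ≤-trans (m≤m+n _ 8) (≤-reflexive (identity m))
  where
  identity : ∀ m → 2 * (8 + m) + 8 ≡ 2 * (9 + m) + 2 + 4
  identity = solve-∀
admissible m r (there (there (there (here refl)))) = m≤n+m (5 + m) 4 ,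
  ≤-trans (m≤m+n _ 8) (≤-reflexive (identity m))
  where
  identity : ∀ m → (5 + m) * (8 + m) + 8 ≡ 2 * (9 + m) + (5 + m) * (4 + m) + 2 * (5 + m)
  identity = solve-∀
admissible m r (there (there (there (there (here refl))))) = m≤n+m (6 + m) 3 ,
  ≤-trans (m≤m+n _ (12 + m)) (≤-reflexive (identity m))
  where
  identity : ∀ m → (6 + m) * (8 + m) + (12 + m) ≡ 2 * (9 + m) + (6 + m) * (5 + m) + 2 * (6 + m)
  identity = solve-∀
admissible m r (there (there (there (there (there (here refl)))))) = m≤n+m (7 + m) 2 ,
  ≤-trans (m≤m+n _ (18 + 2 * m)) (≤-reflexive (identity m))
  where
  identity : ∀ m → (7 + m) * (8 + m) + (18 + 2 * m) ≡ 2 * (9 + m) + (7 + m) * (6 + m) + 2 * (7 + m)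
  identity = solve-∀
admissible m r (there (there (there (there (there (there (here refl))))))) = m≤n+m (8 + m) 1 ,
  ≤-trans (m≤m+n _ (26 + 3 * m)) (≤-reflexive (identity m))
  where
  identity : ∀ m → (8 + m) * (8 + m) + (26 + 3 * m) ≡ 2 * (9 + m) + (8 + m) * (7 + m) + 2 * (8 + m)
  identity = solve-∀

theorem4p1 : (p n k r : ℕ) → p ≥ n → (n≥10 : n ≥ 10) → k ≥ 1 →
    r ∈ (0 ∷ 1 ∷ 2 ∷ n ∸ 5 ∷ n ∸ 4 ∷ n ∸ 3 ∷ n ∸ 2 ∷ []) →
    p ≡ k * (n ∸ 1) + r →
    ∃[ e ] (IsEx p (T³ n (≤-trans (m≤m+n 6 4) n≥10)) e ×
    (+ e) / 1 ≡ ((+ n ℤ.- + 2) ℤ.* + p ℤ.- + r ℤ.* (+ n ℤ.- + 1 ℤ.- + r)) / 2)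
theorem4p1 p n@(suc (suc (suc (suc (suc (suc (suc (suc (suc (suc m))))))))))
  k r p≥n n≥10@(s≤s (s≤s (s≤s (s≤s (s≤s (s≤s (s≤s (s≤s (s≤s (s≤s _)))))))))) k≥1 r∈ refl =
  e , record { attained = cliques (k * suc L + r) , cliques-free m n≥6 refl , refl
             ; upperBound = upper } ,
  trans (half e) (cong (λ x → x / 2) (sym (formula m k r e r≤N (edges k r≤N))))
  where
  L = 8 + m
  n≥6 = ≤-trans (m≤m+n 6 4) n≥10
  open Cliques L
  -- With this witness attainment is immediate, and `edges` supplies its value.
  e = edgeCount (cliques (k * suc L + r))
  r≤N = proj₁ (admissible m r r∈)
  upper : (G : Graph (k * suc L + r)) → (T³ n n≥6 Free) G → edgeCount G ≤ e
  -- Edge counts are compared after doubling, as degree sums over all vertices.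
  upper G free = *-cancelˡ-≤ 2 (subst₂ _≤_ (handshake G) (sym (edges k r≤N))
    (Induction.bound G m n≥6 free r (proj₂ (admissible m r r∈)) k full #-full))
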